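{- Let $f(D)=D\,g(D)$ be the delta operator associated both with the logarithmic sequence $p_n^\alpha(x)$ and with the sequence of polynomials $p_n(x)=p_n^{(0)}(x)$. Then for all vectors $\alpha$ of integers with finite support: (1) (Transfer Formula) For all integers $n$, $\ p_n^\alpha(x)=f'(D)\,g(D)^{ -n-1}\lambda_n^\alpha(x)$. (2) (Shift Formula) For $n$ neither $0$ nor $-1$, $\ p_n^\alpha(x)=\sigma\,g(D)^{ -n}\lambda_{n-1}^\alpha(x)$. (3) (Recurrence Formula) For $n\neq-1$, $\ p_n^\alpha(x)=\sigma\,f'(D)^{ -1}p_{n-1}^\alpha(x)$. In particular, for the polynomial sequence $p_n(x)$: (1') (Transfer Formula) $p_n(x)=f'(D)\,g(D)^{ -n-1}x^n$ for $n\ge0$. (2') (Shift Formula) $p_n(x)=x\,g(D)^{ -n}x^{n-1}$ for $n\ge1$. (3') (Recurrence Formula) $p_n(x)=x\,f'(D)^{ -1}p_{n-1}(x)$ for $n\ge1$.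
   Context: Vectors $\alpha=(\alpha_1,\alpha_2,\dots)$ are sequences of integers with only finitely many nonzero entries; $(0)$ is the zero vector. For an integer $n$ put $\ell^{(n),\alpha}=x^n(\log x)^{\alpha_1}(\log\log x)^{\alpha_2}\cdots$, regarded as linearly independent formal monomials. The derivative acts termwise on (possibly infinite) formal sums by $$D\ell^{(n),\alpha}=n\,\ell^{(n-1),\alpha}+\sum_{k\ge1}\alpha_k\,\ell^{(n-1),(\alpha_1-1,\dots,\alpha_k-1,\alpha_{k+1},\alpha_{k+2},\dots)}.$$ Roman factorial: $\lfloor n\rceil!=n!$ for $n\ge0$ and $\lfloor n\rceil!=(-1)^{n-1}/(-n-1)!$ for $n<0$; $\lfloor n\rceil=n$ for $n\neq0$ and $\lfloor 0\rceil=1$. The harmonic logarithm of degree $n$ and order $\alpha$ is the formal series $$\lambda_n^\alpha(x)=\sum_{\rho}\lfloor n\rceil!\,s(-n,\rho_1)\Bigl[\prod_{i\ge1}e_{\rho_i-\rho_{i+1}}(\alpha_i,\alpha_i-1,\dots,\alpha_i-\rho_i+1)\Bigr]\ell^{(n),\alpha-\rho},$$ over all weakly decreasing sequences $\rho=(\rho_1,\rho_2,\dots)$ of nonnegative integers with finitely many nonzero terms. Here $s(m,k)$ ($m\in\mathbb Z$, $k\ge0$) is the coefficient of $y^k$ in the Taylor expansion at $0$ of $\Gamma(y+1)/\Gamma(y-m+1)$, and $e_k$ is the $k$-th elementary symmetric function of the listed arguments. In particular $\lambda_n^{(0)}=x^n$ for $n\ge0$ and $\lambda_n^{(0)}=0$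 for $n<0$. $\mathcal L^\alpha$ is the complex vector space of all formal series $\sum_{n\le N}c_n\lambda_n^\alpha(x)$, $N\in\mathbb Z$, $c_n\in\mathbb C$. One has $D\lambda_n^\alpha=\lfloor n\rceil\lambda_{n-1}^\alpha$; formal power series in $D$ act termwise on each $\mathcal L^\alpha$. A delta operator is $f(D)=\sum_{k\ge1}a_kD^k$ with $a_k\in\mathbb C$, $a_1\ne0$; then $g(D)=f(D)/D$ and $f'(D)=\sum_{k\ge1}ka_kD^{k-1}$ are invertible formal power series in $D$. The Roman shift $\sigma$ is the linear operator defined termwise by $\sigma\lambda_n^\alpha=\lambda_{n+1}^\alpha$ for $n\ne-1$ and $\sigma\lambda_{ -1}^\alpha=0$. The augmentation $\langle\ \rangle_\alpha$ is the linear functional giving the coefficient of $\lambda_0^\alpha$. A logarithmic sequence is a family $p_n^\alpha(x)$ ($n\in\mathbb Z$, $\alpha$ a vector) with $p_n^\alpha=\sum_{k\le n}c_k\lambda_k^\alpha$, $c_n\ne0$ (for $\alpha=(0)$: polynomials of degree $n$ for $n\ge0$, and $0$ for $n<0$). The logarithmic sequence associated with $f(D)$ is the unique one satisfying $\langle p_n^\alpha\rangle_\alpha=\delta_{n0}$ and $f(D)p_n^\alpha=\lfloor n\rceil p_{n-1}^\alpha$ for all $n,\alpha$.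
   Formalization: The Recurrence Formula (3) is stated for all n ≠ 0 instead of n ≠ -1: at n = 0 it fails, since σ f'(D)^{ -1} p_{ -1}^α has no λ_0^α term while p_0^α has coefficient 1 there; the case n = -1 is included. -}

module Defs where

open import Algebra.Apartness.Bundles using (HeytingField; HeytingCommutativeRing)
open import Algebra.Bundles using (CommutativeRing; Monoid)
import Algebra.Apartness.Properties.HeytingCommutativeRing as HeytingProperties
import Algebra.Definitions.RawMonoid as RawMonoidDefinitions
import Algebra.Properties.Monoid.Sum as MonoidSum
open import Data.Bool.Base using (true; false; if_then_else_; _∧_)
open import Data.Fin.Base using (Fin; toℕ)
open import Data.Integer.Base as ℤ using (ℤ; +_; -[1+_]; 0ℤ; 1ℤ; -1ℤ; ∣_∣)
import Data.Integer.Properties as ℤP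
open import Data.List.Base using (List; []; _∷_; applyUpTo)
open import Data.Nat.Base as ℕ using (ℕ; zero; suc; NonZero; _!; z≤n; s≤s)
import Data.Nat.Properties as ℕP
open import Data.Product.Base using (_×_; _,_; proj₁; proj₂; ∃-syntax)
open import Level using (_⊔_)
open import Relation.Binary.PropositionalEquality as ≡ using (_≡_)
open import Relation.Nullary.Decidable using (Dec; does; yes; no; map′; _×-dec_; dec-true; dec-false)

-- `entry α i` is α_{i+1}.
record Vector : Set where
  constructor mkVector
  field
    entry    : ℕ → ℤ
    bound    : ℕ
    vanishes : ∀ i → bound ℕ.≤ i → entry i ≡ 0ℤ

open Vector public

infix 4 _≐_
_≐_ : Vector → Vector → Set
α ≐ β = ∀ i → entry α i ≡ entry β i

0ᵥ : Vector
0ᵥ = mkVector (λ _ → 0ℤ) 0 (λ _ _ → ≡.refl)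

-- (1,…,1,0,0,…) with k ones.
ones : ℕ → Vector
ones k = mkVector (λ i → if does (i ℕP.<? k) then 1ℤ else 0ℤ) k
  λ i k≤i → ≡.cong (if_then 1ℤ else 0ℤ) (dec-false (i ℕP.<? k) (ℕP.≤⇒≯ k≤i))

infixl 6 _+ᵥ_ _-ᵥ_

_+ᵥ_ : Vector → Vector → Vector
α +ᵥ β = mkVector (λ i → entry α i ℤ.+ entry β i) (bound α ℕ.⊔ bound β)
  λ i b≤i → ≡.cong₂ ℤ._+_ (vanishes α i (ℕP.m⊔n≤o⇒m≤o _ _ b≤i))
                          (vanishes β i (ℕP.m⊔n≤o⇒n≤o _ _ b≤i))

_-ᵥ_ : Vector → Vector → Vector
α -ᵥ β = mkVector (λ i → entry α i ℤ.- entry β i) (bound α ℕ.⊔ bound β)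
  λ i b≤i → ≡.cong₂ ℤ._-_ (vanishes α i (ℕP.m⊔n≤o⇒m≤o _ _ b≤i))
                          (vanishes β i (ℕP.m⊔n≤o⇒n≤o _ _ b≤i))

_≐?_ : ∀ α β → Dec (α ≐ β)
α ≐? β = map′ extend (λ eq {i} _ → eq i)
              (ℕP.allUpTo? (λ i → entry α i ℤP.≟ entry β i) b)
  where
  b = bound α ℕ.⊔ bound β
  extend : (∀ {i} → i ℕ.< b → entry α i ≡ entry β i) → α ≐ β
  extend eq i with i ℕP.<? b
  ... | yes i<b = eq i<b
  ... | no  i≮b = ≡.trans (vanishes α i (ℕP.m⊔n≤o⇒m≤o _ _ (ℕP.≮⇒≥ i≮b)))
                   (≡.sym (vanishes β i (ℕP.m⊔n≤o⇒n≤o _ _ (ℕP.≮⇒≥ i≮b))))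

IsPartition : Vector → Set
IsPartition ρ = ∀ i → 0ℤ ℤ.≤ entry ρ i × entry ρ (suc i) ℤ.≤ entry ρ i

isPartition? : ∀ ρ → Dec (IsPartition ρ)
isPartition? ρ = map′ extend (λ p {i} _ → p i)
  (ℕP.allUpTo? (λ i → (0ℤ ℤP.≤? entry ρ i) ×-dec (entry ρ (suc i) ℤP.≤? entry ρ i)) (bound ρ))
  where
  extend : (∀ {i} → i ℕ.< bound ρ → 0ℤ ℤ.≤ entry ρ i × entry ρ (suc i) ℤ.≤ entry ρ i) →
           IsPartition ρ
  extend p i with i ℕP.<? bound ρ
  ... | yes i<b = p i<b
  ... | no  i≮b = ℤP.≤-reflexive (≡.sym (vanishes ρ i b≤i)) ,
                  ℤP.≤-reflexive (≡.trans (vanishes ρ (suc i) (ℕP.m≤n⇒m≤1+n b≤i))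
                                          (≡.sym (vanishes ρ i b≤i)))
    where b≤i = ℕP.≮⇒≥ i≮b

IsPartition-cong : ∀ {ρ τ} → ρ ≐ τ → IsPartition ρ → IsPartition τ
IsPartition-cong eq p i =
  ≡.subst (0ℤ ℤ.≤_) (eq i) (proj₁ (p i)) ,
  ≡.subst₂ ℤ._≤_ (eq (suc i)) (eq i) (proj₂ (p i))

does-⇔ : ∀ {a b} {A : Set a} {B : Set b} (A? : Dec A) (B? : Dec B) →
         (A → B) → (B → A) → does A? ≡ does B?
does-⇔ (yes a) B? f g = ≡.sym (dec-true B? (f a))
does-⇔ (no ¬a) B? f g = ≡.sym (dec-false B? (λ b → ¬a (g b)))

module _ {c ℓ} (M : Monoid c ℓ) where
  open Monoid M
  open MonoidSum M using (sum; sum-syntax)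

  sum-zero : ∀ n (f : ℕ → Carrier) → (∀ i → i ℕ.< n → f i ≈ ε) → ∑[ i < n ] f (toℕ i) ≈ ε
  sum-zero zero    f f≈0 = refl
  sum-zero (suc n) f f≈0 =
    trans (∙-cong (f≈0 0 (s≤s z≤n)) (sum-zero n (λ i → f (suc i)) (λ i i<n → f≈0 (suc i) (s≤s i<n))))
          (identityˡ ε)

  sum-cong : ∀ n {f g : ℕ → Carrier} → (∀ i → f i ≈ g i) →
             ∑[ i < n ] f (toℕ i) ≈ ∑[ i < n ] g (toℕ i)
  sum-cong n f≈g = MonoidSum.sum-cong-≋ M {n} (λ i → f≈g (toℕ i))

  sum-extend : ∀ {m n} (f : ℕ → Carrier) → m ℕ.≤ n → (∀ i → m ℕ.≤ i → f i ≈ ε) →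
               ∑[ i < m ] f (toℕ i) ≈ ∑[ i < n ] f (toℕ i)
  sum-extend {n = n} f z≤n f≈0 = sym (sum-zero n f (λ i _ → f≈0 i z≤n))
  sum-extend f (s≤s m≤n) f≈0 =
    ∙-congˡ (sum-extend (λ i → f (suc i)) m≤n (λ i m≤i → f≈0 (suc i) (s≤s m≤i)))

  sum-range : ∀ m n {f g : ℕ → Carrier} → (∀ i → f i ≈ g i) →
              (∀ i → m ℕ.≤ i → f i ≈ ε) → (∀ i → n ℕ.≤ i → g i ≈ ε) →
              ∑[ i < m ] f (toℕ i) ≈ ∑[ i < n ] g (toℕ i)
  sum-range m n {f} {g} f≈g f≈0 g≈0 =
    trans (sum-extend f (ℕP.m≤m⊔n m n) f≈0)
   (trans (sum-cong (m ℕ.⊔ n) f≈g)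
     (sym (sum-extend g (ℕP.m≤n⊔m m n) g≈0)))

elementary : ℕ → List ℤ → ℤ
elementary zero    _        = 1ℤ
elementary (suc k) []       = 0ℤ
elementary (suc k) (x ∷ xs) = x ℤ.* elementary k xs ℤ.+ elementary (suc k) xs

-- a , a - 1 , … , a - m + 1
descending : ℤ → ℕ → List ℤ
descending a m = applyUpTo (λ j → a ℤ.- + j) m

∏-syntax : ∀ n → (Fin n → ℤ) → ℤ
∏-syntax n = MonoidSum.sum ℤP.*-1-monoid

syntax ∏-syntax n (λ i → x) = ∏[ i < n ] x

partitionFactor : Vector → Vector → ℕ → ℤ
partitionFactor α ρ i =
  elementary (∣ entry ρ i ∣ ℕ.∸ ∣ entry ρ (suc i) ∣) (descending (entry α i) ∣ entry ρ i ∣)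

-- From `bound ρ` on, all the factors are e₀() = 1.
partitionProduct : Vector → Vector → ℤ
partitionProduct α ρ = ∏[ i < bound ρ ] partitionFactor α ρ (toℕ i)

partitionProduct-cong : ∀ α {ρ τ} → ρ ≐ τ → partitionProduct α ρ ≡ partitionProduct α τ
partitionProduct-cong α {ρ} {τ} eq =
  sum-range ℤP.*-1-monoid (bound ρ) (bound τ) same (trivial ρ) (trivial τ)
  where
  same : ∀ i → partitionFactor α ρ i ≡ partitionFactor α τ i
  same i rewrite eq i | eq (suc i) = ≡.refl
  trivial : ∀ σ i → bound σ ℕ.≤ i → partitionFactor α σ i ≡ 1ℤ
  trivial σ i b≤i rewrite vanishes σ i b≤i | vanishes σ (suc i) (ℕP.m≤n⇒m≤1+n b≤i) = ≡.refl

CharacteristicZero : ∀ {c ℓ₁ ℓ₂} → HeytingField c ℓ₁ ℓ₂ → Set ℓ₂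
CharacteristicZero K = ∀ n → .{{NonZero n}} → (n · 1#) # 0#
  where
  open HeytingField K
  open CommutativeRing (HeytingCommutativeRing.commutativeRing heytingCommutativeRing) using (+-rawMonoid)
  open RawMonoidDefinitions +-rawMonoid using () renaming (_×_ to _·_)

module LogarithmicAlgebra {c ℓ₁ ℓ₂} (K : HeytingField c ℓ₁ ℓ₂) (char0 : CharacteristicZero K) where

  open HeytingField K
  open CommutativeRing (HeytingCommutativeRing.commutativeRing heytingCommutativeRing)
    using (+-monoid; +-rawMonoid)
  open RawMonoidDefinitions +-rawMonoid using () renaming (_×_ to _·_)
  open MonoidSum +-monoid using (sum; sum-syntax)
  open HeytingProperties heytingCommutativeRing using (#-congʳ)

  recip : ∀ {x} → x # 0# → Carrier
  recip x#0 = proj₁ (#⇒invertible x#0)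

  fromℤ : ℤ → Carrier
  fromℤ (+ n)    = n · 1#
  fromℤ -[1+ n ] = - (suc n · 1#)

  PowerSeries : Set c
  PowerSeries = ℕ → Carrier

  infixl 7 _⊛_
  infixr 8 _^_

  one : PowerSeries
  one zero    = 1#
  one (suc _) = 0#

  _⊛_ : PowerSeries → PowerSeries → PowerSeries
  (a ⊛ b) n = ∑[ i < suc n ] (a (toℕ i) * b (n ℕ.∸ toℕ i))

  _^_ : PowerSeries → ℕ → PowerSeries
  a ^ zero  = one
  a ^ suc n = a ⊛ a ^ n

  derivative : PowerSeries → PowerSeries
  derivative a n = suc n · a (suc n)

  -- 1/a = a₀⁻¹ Σ_k (1 - a₀⁻¹ a)^k ; the terms with k > n have no coefficient of degree n.
  inverse : (a : PowerSeries) → a 0 # 0# → PowerSeries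
  inverse a a₀#0 n = recip a₀#0 * ∑[ k < suc n ] ((u ^ toℕ k) n)
    where
    u : PowerSeries
    u i = one i - recip a₀#0 * a i

  zpower : (a : PowerSeries) → a 0 # 0# → ℤ → PowerSeries
  zpower a a₀#0 (+ n)    = a ^ n
  zpower a a₀#0 -[1+ n ] = inverse a a₀#0 ^ suc n

  ⌊_⌉ : ℤ → Carrier
  ⌊ + zero ⌉ = 1#
  ⌊ n ⌉      = fromℤ n

  -- For n = -(m+1) one has (-1)^(n-1) = (-1)^m and (-n-1)! = m!.
  ⌊_⌉! : ℤ → Carrier
  ⌊ + n ⌉!      = fromℤ (+ (n !))
  ⌊ -[1+ m ] ⌉! = fromℤ (-1ℤ ℤ.^ m) * recip (char0 (m !) {{m ℕP.!≢0}})

  y+_ : Carrier → PowerSeries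
  (y+ a) zero          = a
  (y+ a) (suc zero)    = 1#
  (y+ a) (suc (suc _)) = 0#

  -- By Γ(z+1) = zΓ(z), the function Γ(y+1)/Γ(y-m+1) is y(y-1)⋯(y-m+1) for m ≥ 0 ...
  falling : ℕ → PowerSeries
  falling zero    = one
  falling (suc m) = falling m ⊛ (y+ fromℤ (ℤ.- (+ m)))

  -- ... and Γ(y+1)/Γ(y+m+1) is 1/((y+1)⋯(y+m)).
  recipRising : ℕ → PowerSeries
  recipRising zero    = one
  recipRising (suc m) = recipRising m ⊛ inverse (y+ fromℤ (+ suc m)) (char0 (suc m))

  gammaQuotient : ℤ → PowerSeries
  gammaQuotient (+ m)    = falling m
  gammaQuotient -[1+ m ] = recipRising (suc m)

  stirling : ℤ → ℕ → Carrier
  stirling m k = gammaQuotient m k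

  -- `coeff n β` is the coefficient of ℓ^{(n),β}.  The degree in x is bounded
  -- above, and only the first `width` of the iterated logarithms may have a
  -- positive exponent.  The series Σ c_n λ_n^α satisfy both conditions, and they
  -- make every coefficient of the termwise action of f(D) a finite sum.
  record LogSeries : Set (c ⊔ ℓ₁) where
    field
      coeff        : ℤ → Vector → Carrier
      degree       : ℤ
      width        : ℕ
      coeff-cong   : ∀ n β γ → β ≐ γ → coeff n β ≈ coeff n γ
      degree-bound : ∀ n β → degree ℤ.< n → coeff n β ≈ 0#
      width-bound  : ∀ n β i → width ℕ.≤ i → 0ℤ ℤ.< entry β i → coeff n β ≈ 0#

  open LogSeries public

  infix 4 _≋_
  _≋_ : LogSeries → LogSeries → Set ℓ₁
  F ≋ G = ∀ n β → coeff F n β ≈ coeff G n β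

  infixr 7 _•_
  _•_ : Carrier → LogSeries → LogSeries
  a • F = record
    { coeff        = λ n β → a * coeff F n β
    ; degree       = degree F
    ; width        = width F
    ; coeff-cong   = λ n β γ eq → *-congˡ (coeff-cong F n β γ eq)
    ; degree-bound = λ n β d<n → trans (*-congˡ (degree-bound F n β d<n)) (zeroʳ a)
    ; width-bound  = λ n β i w≤i pos → trans (*-congˡ (width-bound F n β i w≤i pos)) (zeroʳ a)
    }

  ℓ : ℤ → Vector → LogSeries
  ℓ n α = record
    { coeff        = λ m β → if does (m ℤP.≟ n) ∧ does (α ≐? β) then 1# else 0#
    ; degree       = n
    ; width        = bound α
    ; coeff-cong   = λ m β γ eq → reflexive
        (≡.cong (λ b → if does (m ℤP.≟ n) ∧ b then 1# else 0#)
          (does-⇔ (α ≐? β) (α ≐? γ) (λ p i → ≡.trans (p i) (eq i))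
                                    (λ p i → ≡.trans (p i) (≡.sym (eq i)))))
    ; degree-bound = λ m β n<m → reflexive
        (≡.cong (λ b → if b ∧ does (α ≐? β) then 1# else 0#)
          (dec-false (m ℤP.≟ n) (λ m≡n → ℤP.<-irrefl (≡.sym m≡n) n<m)))
    ; width-bound  = λ m β i b≤i pos → reflexive
        (≡.trans
          (≡.cong (λ b → if does (m ℤP.≟ n) ∧ b then 1# else 0#)
            (dec-false (α ≐? β) (λ eq →
              ℤP.<-irrefl (≡.trans (≡.sym (vanishes α i b≤i)) (eq i)) pos)))
          (∧-false (does (m ℤP.≟ n))))
    }
    where
    ∧-false : ∀ b → (if b ∧ false then 1# else 0#) ≡ 0#
    ∧-false true  = ≡.refl
    ∧-false false = ≡.refl

  infixr 7 x·_
  x·_ : LogSeries → LogSeries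
  x· F = record
    { coeff        = λ n β → coeff F (ℤ.pred n) β
    ; degree       = ℤ.suc (degree F)
    ; width        = width F
    ; coeff-cong   = λ n → coeff-cong F (ℤ.pred n)
    ; degree-bound = λ n β d<n → degree-bound F (ℤ.pred n) β
        (≡.subst (ℤ._< ℤ.pred n) (ℤP.pred-suc (degree F)) (ℤP.+-monoʳ-< -1ℤ d<n))
    ; width-bound  = λ n β i → width-bound F (ℤ.pred n) β i
    }

  -- The monomials whose derivative involves ℓ^{(n),β} are ℓ^{(n+1),β} and
  -- ℓ^{(n+1),α} with α = β + (1,…,1,0,…), where α_k = β_k + 1 if there are k ones.
  derivativeTerm : LogSeries → ℤ → Vector → ℕ → Carrier
  derivativeTerm F n β i =
    fromℤ (entry β i ℤ.+ 1ℤ) * coeff F (ℤ.suc n) (β +ᵥ ones (suc i))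

  0≤ones : ∀ k j → 0ℤ ℤ.≤ entry (ones k) j
  0≤ones k j with j ℕ.<ᵇ k
  ... | true  = ℤ.+≤+ z≤n
  ... | false = ℤ.+≤+ z≤n

  ones-last : ∀ i → entry (ones (suc i)) i ≡ 1ℤ
  ones-last i = ≡.cong (if_then 1ℤ else 0ℤ) (dec-true (i ℕP.<? suc i) (ℕP.n<1+n i))

  derivativeTerm-zero : ∀ F n β i → width F ℕ.⊔ bound β ℕ.≤ i → derivativeTerm F n β i ≈ 0#
  derivativeTerm-zero F n β i b≤i =
    trans (*-congˡ (width-bound F (ℤ.suc n) (β +ᵥ ones (suc i)) i
                      (ℕP.m⊔n≤o⇒m≤o _ _ b≤i)
                      (≡.subst (0ℤ ℤ.<_)
                        (≡.sym (≡.cong₂ ℤ._+_ (vanishes β i (ℕP.m⊔n≤o⇒n≤o _ _ b≤i))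
                                              (ones-last i)))
                        (ℤ.+<+ (s≤s z≤n)))))
          (zeroʳ _)

  derivativeTerm-cong : ∀ F n β γ → β ≐ γ → ∀ i →
                        derivativeTerm F n β i ≈ derivativeTerm F n γ i
  derivativeTerm-cong F n β γ eq i =
    *-cong (reflexive (≡.cong (λ z → fromℤ (z ℤ.+ 1ℤ)) (eq i)))
           (coeff-cong F (ℤ.suc n) (β +ᵥ ones (suc i)) (γ +ᵥ ones (suc i))
             (λ j → ≡.cong (ℤ._+ entry (ones (suc i)) j) (eq j)))

  -- Beyond width F ⊔ bound β the terms vanish, by derivativeTerm-zero.
  D : LogSeries → LogSeries
  D F = record
    { coeff        = λ n β → fromℤ (ℤ.suc n) * coeff F (ℤ.suc n) β
                             + ∑[ i < width F ℕ.⊔ bound β ] derivativeTerm F n β (toℕ i)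
    ; degree       = ℤ.pred (degree F)
    ; width        = width F
    ; coeff-cong   = λ n β γ eq → +-cong (*-congˡ (coeff-cong F (ℤ.suc n) β γ eq))
        (sum-range +-monoid (width F ℕ.⊔ bound β) (width F ℕ.⊔ bound γ)
          (derivativeTerm-cong F n β γ eq) (derivativeTerm-zero F n β) (derivativeTerm-zero F n γ))
    ; degree-bound = λ n β d<n →
        let d<1+n = ≡.subst (ℤ._< ℤ.suc n) (ℤP.suc-pred (degree F)) (ℤP.+-monoʳ-< 1ℤ d<n) in
        zero-sum β (degree-bound F (ℤ.suc n) β d<1+n)
                   (λ i → degree-bound F (ℤ.suc n) (β +ᵥ ones (suc i)) d<1+n)
    ; width-bound  = λ n β j w≤j pos →
        zero-sum β (width-bound F (ℤ.suc n) β j w≤j pos)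
                   (λ i → width-bound F (ℤ.suc n) (β +ᵥ ones (suc i)) j w≤j
                            (ℤP.+-mono-<-≤ pos (0≤ones (suc i) j)))
    }
    where
    zero-sum : ∀ {n} β → coeff F n β ≈ 0# → (∀ i → coeff F n (β +ᵥ ones (suc i)) ≈ 0#) →
               fromℤ n * coeff F n β
               + ∑[ i < width F ℕ.⊔ bound β ]
                   (fromℤ (entry β (toℕ i) ℤ.+ 1ℤ) * coeff F n (β +ᵥ ones (suc (toℕ i)))) ≈ 0#
    zero-sum {n} β z zs =
      trans (+-cong (trans (*-congˡ z) (zeroʳ _))
                    (sum-zero +-monoid (width F ℕ.⊔ bound β)
                      (λ i → fromℤ (entry β i ℤ.+ 1ℤ) * coeff F n (β +ᵥ ones (suc i)))
                      (λ i _ → trans (*-congˡ (zs i)) (zeroʳ _))))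
            (+-identityˡ 0#)

  D^ : ℕ → LogSeries → LogSeries
  D^ zero    F = F
  D^ (suc k) F = D (D^ k F)

  D^-degree : ∀ k F → degree (D^ k F) ℤ.≤ degree F
  D^-degree zero    F = ℤP.≤-refl
  D^-degree (suc k) F = ℤP.≤-trans (ℤP.i≤j⇒pred[i]≤j ℤP.≤-refl) (D^-degree k F)

  D^-width : ∀ k F → width (D^ k F) ≡ width F
  D^-width zero    F = ≡.refl
  D^-width (suc k) F = D^-width k F

  -- The action of Σ a_k D^k.  As D^k F has no terms of degree n once
  -- k > degree F - n, the sum may be cut off at ∣ degree F - n ∣.
  infixr 7 _⟨D⟩_
  _⟨D⟩_ : PowerSeries → LogSeries → LogSeries
  a ⟨D⟩ F = record
    { coeff        = λ n β → ∑[ k < range n ] (a (toℕ k) * coeff (D^ (toℕ k) F) n β)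
    ; degree       = degree F
    ; width        = width F
    ; coeff-cong   = λ n β γ eq → sum-cong +-monoid (range n)
        {λ k → a k * coeff (D^ k F) n β} {λ k → a k * coeff (D^ k F) n γ}
        (λ k → *-congˡ (coeff-cong (D^ k F) n β γ eq))
    ; degree-bound = λ n β d<n → zero-sum n β
        (λ k → degree-bound (D^ k F) n β (ℤP.≤-<-trans (D^-degree k F) d<n))
    ; width-bound  = λ n β i w≤i pos → zero-sum n β
        (λ k → width-bound (D^ k F) n β i (≡.subst (ℕ._≤ i) (≡.sym (D^-width k F)) w≤i) pos)
    }
    where
    range : ℤ → ℕ
    range n = suc ∣ degree F ℤ.- n ∣
    zero-sum : ∀ n β → (∀ k → coeff (D^ k F) n β ≈ 0#) →
               ∑[ k < range n ] (a (toℕ k) * coeff (D^ (toℕ k) F) n β) ≈ 0#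
    zero-sum n β z = sum-zero +-monoid (range n) (λ k → a k * coeff (D^ k F) n β)
      (λ k _ → trans (*-congˡ (z k)) (zeroʳ _))

  -- The coefficient of ℓ^{(n),α-ρ} in λ_n^α; a vector ρ that is not a partition
  -- does not index a term of the series.
  harmonicCoeff : ℤ → Vector → Vector → Carrier
  harmonicCoeff n α ρ =
    if does (isPartition? ρ)
    then ⌊ n ⌉! * stirling (ℤ.- n) ∣ entry ρ 0 ∣ * fromℤ (partitionProduct α ρ)
    else 0#

  harmonicCoeff-cong : ∀ n α {ρ τ} → ρ ≐ τ → harmonicCoeff n α ρ ≡ harmonicCoeff n α τ
  harmonicCoeff-cong n α {ρ} {τ} eq
    rewrite does-⇔ (isPartition? ρ) (isPartition? τ)
              (IsPartition-cong {ρ} {τ} eq) (IsPartition-cong {τ} {ρ} (λ i → ≡.sym (eq i)))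
          | eq 0 | partitionProduct-cong α {ρ} {τ} eq = ≡.refl

  harmonicCoeff-zero : ∀ n α β i → bound α ℕ.≤ i → 0ℤ ℤ.< entry β i →
                       harmonicCoeff n α (α -ᵥ β) ≡ 0#
  harmonicCoeff-zero n α β i b≤i pos
    rewrite dec-false (isPartition? (α -ᵥ β)) (λ p →
      ℤP.<⇒≱ pos (ℤP.0≤i-j⇒j≤i
        (≡.subst (λ z → 0ℤ ℤ.≤ z ℤ.- entry β i) (vanishes α i b≤i) (proj₁ (p i))))) = ≡.refl

  harmonicLog : ℤ → Vector → LogSeries
  harmonicLog n α = record
    { coeff        = λ m β → if does (m ℤP.≟ n) then harmonicCoeff n α (α -ᵥ β) else 0#
    ; degree       = n
    ; width        = bound α
    ; coeff-cong   = λ m β γ eq → reflexive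
        (≡.cong (λ z → if does (m ℤP.≟ n) then z else 0#)
          (harmonicCoeff-cong n α {α -ᵥ β} {α -ᵥ γ} (λ i → ≡.cong (λ z → entry α i ℤ.- z) (eq i))))
    ; degree-bound = λ m β n<m → reflexive
        (≡.cong (if_then harmonicCoeff n α (α -ᵥ β) else 0#)
          (dec-false (m ℤP.≟ n) (λ m≡n → ℤP.<-irrefl (≡.sym m≡n) n<m)))
    ; width-bound  = λ m β i b≤i pos → reflexive
        (≡.trans (≡.cong (λ z → if does (m ℤP.≟ n) then z else 0#)
                   (harmonicCoeff-zero n α β i b≤i pos))
                 (if-same (does (m ℤP.≟ n))))
    }
    where
    if-same : ∀ b → (if b then 0# else 0#) ≡ 0#
    if-same true  = ≡.refl
    if-same false = ≡.refl

  record Expansion : Set (c ⊔ ℓ₁) where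
    field
      coef       : ℤ → Carrier
      top        : ℤ
      coef-bound : ∀ n → top ℤ.< n → coef n ≈ 0#

  open Expansion public

  -- Σ c_n λ_n^α: as λ_n^α is homogeneous of degree n in x, the coefficient of
  -- ℓ^{(n),β} comes from the n-th summand only.
  expand : Vector → Expansion → LogSeries
  expand α S = record
    { coeff        = λ n β → coef S n * coeff (harmonicLog n α) n β
    ; degree       = top S
    ; width        = bound α
    ; coeff-cong   = λ n β γ eq → *-congˡ (coeff-cong (harmonicLog n α) n β γ eq)
    ; degree-bound = λ n β t<n → trans (*-congʳ (coef-bound S n t<n)) (zeroˡ _)
    ; width-bound  = λ n β i b≤i pos →
        trans (*-congˡ (width-bound (harmonicLog n α) n β i b≤i pos)) (zeroʳ _)
    }

  shiftExpansion : Expansion → Expansion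
  shiftExpansion S = record
    { coef       = λ n → if does (n ℤP.≟ 0ℤ) then 0# else coef S (ℤ.pred n)
    ; top        = ℤ.suc (top S)
    ; coef-bound = bnd
    }
    where
    bnd : ∀ n → ℤ.suc (top S) ℤ.< n →
          (if does (n ℤP.≟ 0ℤ) then 0# else coef S (ℤ.pred n)) ≈ 0#
    bnd n t<n with does (n ℤP.≟ 0ℤ)
    ... | true  = refl
    ... | false = coef-bound S (ℤ.pred n)
        (≡.subst (ℤ._< ℤ.pred n) (ℤP.pred-suc (top S)) (ℤP.+-monoʳ-< -1ℤ t<n))

  -- G ≋σ[ α ] F : F lies in 𝓛^α and G = σF.  For α = (0) the coefficients of
  -- λ_n^{(0)} = 0, n < 0, are not determined by F; neither σF nor ⟨F⟩ depends on them.
  infix 4 _≋σ[_]_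
  _≋σ[_]_ : LogSeries → Vector → LogSeries → Set (c ⊔ ℓ₁)
  G ≋σ[ α ] F = ∃[ S ] (F ≋ expand α S) × (G ≋ expand α (shiftExpansion S))

  -- ⟨ F ⟩[ α ]≈ v : F lies in 𝓛^α and the coefficient of λ_0^α in F is v.
  infix 4 ⟨_⟩[_]≈_
  ⟨_⟩[_]≈_ : LogSeries → Vector → Carrier → Set (c ⊔ ℓ₁)
  ⟨ F ⟩[ α ]≈ v = ∃[ S ] (F ≋ expand α S) × (coef S 0ℤ ≈ v)

  record DeltaOperator : Set (c ⊔ ℓ₁ ⊔ ℓ₂) where
    field
      series   : PowerSeries
      constant : series 0 ≈ 0#
      linear   : series 1 # 0#

    quotient : PowerSeries
    quotient k = series (suc k)

    infix 9 g^_
    g^_ : ℤ → PowerSeries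
    g^ n = zpower quotient linear n

    f′ : PowerSeries
    f′ = derivative series

    f′⁻¹ : PowerSeries
    f′⁻¹ = inverse f′ (#-congʳ (sym (+-identityʳ (series 1))) linear)

  IsLogarithmicSequence : (ℤ → Vector → LogSeries) → Set (c ⊔ ℓ₁ ⊔ ℓ₂)
  IsLogarithmicSequence p =
    ∀ n α → ∃[ S ] top S ≡ n × coef S n # 0# × p n α ≋ expand α S

  IsAssociated : DeltaOperator → (ℤ → Vector → LogSeries) → Set (c ⊔ ℓ₁)
  IsAssociated f p = ∀ n α →
    (⟨ p n α ⟩[ α ]≈ (if does (n ℤP.≟ 0ℤ) then 1# else 0#)) ×
    (DeltaOperator.series f ⟨D⟩ p n α ≋ ⌊ n ⌉ • p (n ℤ.- 1ℤ) α)

{-# OPTIONS --safe #-}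

-- Identifying λ_m^α / ⌊m⌉! with D^{-m}, on which D acts as a shift, turns 𝓛^α into
-- the Laurent series in D with their module structure over power series (for
-- α = (0) only modulo D K[[D]], since λ_m^{(0)} = 0 for m < 0).  Then p_n^α is
-- ⌊n⌉! k_n(D) D^{-n} where g k_{n+1} = k_n and [D^j] k_j = δ_{j0}, and these
-- equations have a unique solution.  The series f′ g^{-n-1} satisfies them by the
-- residue identity n [D^j] f′ g^{-n-1} = (n - j) [D^j] g^{-n}, which follows from
-- f′ = g + θg for the derivation θ = D d/dD.  The same identity is the shift
-- formula, and f′ cancels in the recurrence formula.
-- That D λ_n^α = ⌊n⌉ λ_{n-1}^α reduces to a recurrence for the Stirling numbers
-- and to a Pieri rule for the products of the e's, a telescoping sum obtained from
-- e_d(a,…,a-r+1) = e_d(a,…,a-r+2) + (a-r+1) e_{d-1}(a,…,a-r+2).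
module Submission where

open import Defs
open import Algebra.Apartness.Bundles using (HeytingField; HeytingCommutativeRing)
import Algebra.Apartness.Properties.HeytingCommutativeRing as HeytingProperties
open import Algebra.Bundles using (CommutativeRing; CommutativeSemiring)
import Algebra.Properties.AbelianGroup as AbelianGroupProperties
import Algebra.Properties.Ring as RingProperties
import Algebra.Properties.Semiring.Mult as SemiringMult
import Algebra.Properties.Semiring.Sum as SemiringSum
import Algebra.Solver.Ring.NaturalCoefficients.Default as SemiringSolver
import Algebra.Structures.Biased as Biased
open import Data.Bool.Base using (true; false; if_then_else_; _∧_)
open import Data.Fin.Base using (toℕ)
import Data.Fin.Properties as FinP
open import Data.Integer.Base as ℤ using (ℤ; +_; -[1+_]; 0ℤ; 1ℤ; -1ℤ; ∣_∣)
import Data.Integer.Properties as ℤP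
open import Data.Integer.Tactic.RingSolver using (solve-∀)
open import Data.List.Base using (applyUpTo)
open import Data.Nat.Base as ℕ using (ℕ; zero; suc; z≤n; s≤s; _!)
open import Data.Nat.Induction using (<-rec)
import Data.Nat.Properties as ℕP
open import Data.Product.Base using (_×_; _,_; proj₁; proj₂; ∃-syntax)
open import Data.Sum.Base using (_⊎_; inj₁; inj₂)
open import Function.Base using (_∘_)
open import Relation.Binary.Definitions using (tri<; tri≈; tri>)
open import Relation.Binary.PropositionalEquality as ≡ using (_≡_; _≢_)
import Relation.Binary.Reasoning.Setoid as SetoidReasoning
open import Relation.Binary.Structures using (IsEquivalence)
open import Relation.Nullary.Decidable using (does; yes; no; dec-true; dec-false; ¬?; decidable-stable)
open import Relation.Nullary.Negation using (¬_; contradiction)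

module Partitions where
  open SemiringSum ℤP.+-*-semiring using () renaming (sum to sumℤ; *-distribˡ-sum to *-distribˡ-sumℤ; sum-cong-≋ to sumℤ-cong)
  open ≡.≡-Reasoning

  -- Elementary symmetric functions and telescoping products.

  ∑ℤ : ℕ → (ℕ → ℤ) → ℤ
  ∑ℤ n f = sumℤ {n} (f ∘ toℕ)

  -- `elementary` recurses at the front of the list, whereas lengthening `descending a r` appends an
  -- entry at its end. The subsets of size d + 1 either avoid the last entry or contain it.
  elementary-snoc : ∀ (f : ℕ → ℤ) r d →
    elementary (suc d) (applyUpTo f (suc r)) ≡
    elementary (suc d) (applyUpTo f r) ℤ.+ f r ℤ.* elementary d (applyUpTo f r)
  elementary-snoc f zero    zero    = swap (f 0)
    where
    swap : ∀ a → a ℤ.* 1ℤ ℤ.+ 0ℤ ≡ 0ℤ ℤ.+ a ℤ.* 1ℤ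
    swap = solve-∀
  elementary-snoc f zero    (suc d) = swap (f 0)
    where
    swap : ∀ a → a ℤ.* 0ℤ ℤ.+ 0ℤ ≡ 0ℤ ℤ.+ a ℤ.* 0ℤ
    swap = solve-∀
  elementary-snoc f (suc r) zero
    rewrite elementary-snoc (f ∘ suc) r zero = swap (f 0) _ (f (suc r))
    where
    swap : ∀ a b c → a ℤ.* 1ℤ ℤ.+ (b ℤ.+ c ℤ.* 1ℤ) ≡ a ℤ.* 1ℤ ℤ.+ b ℤ.+ c ℤ.* 1ℤ
    swap = solve-∀
  elementary-snoc f (suc r) (suc d)
    rewrite elementary-snoc (f ∘ suc) r d | elementary-snoc (f ∘ suc) r (suc d) =
    swap (f 0) (f (suc r)) _ _ _
    where
    swap : ∀ a c x y z → a ℤ.* (x ℤ.+ c ℤ.* y) ℤ.+ (z ℤ.+ c ℤ.* x)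
                       ≡ a ℤ.* x ℤ.+ z ℤ.+ c ℤ.* (a ℤ.* y ℤ.+ x)
    swap = solve-∀

  elementary-short : ∀ (f : ℕ → ℤ) {r d} → r ℕ.< d → elementary d (applyUpTo f r) ≡ 0ℤ
  elementary-short f {zero}  (s≤s _)   = ≡.refl
  elementary-short f {suc r} (s≤s r<d)
    rewrite elementary-short (f ∘ suc) r<d | elementary-short (f ∘ suc) (ℕP.m<n⇒m<1+n r<d) =
    ≡.cong (ℤ._+ 0ℤ) (ℤP.*-zeroʳ (f 0))

  -- The k-th summand of the telescoping expansion of ∏ (A i + B i) - ∏ A i.
  telescopeTerm : (A B F : ℕ → ℤ) → ℕ → ℕ → ℤ
  telescopeTerm A B F zero    k       = 0ℤ
  telescopeTerm A B F (suc n) zero    = B 0 ℤ.* ∏[ i < n ] F (suc (toℕ i))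
  telescopeTerm A B F (suc n) (suc k) = A 0 ℤ.* telescopeTerm (A ∘ suc) (B ∘ suc) (F ∘ suc) n k

  -- The k-th summand has `A` before k, `B` at k and `F` after k: it is the difference of two
  -- products in which `F` is replaced by `A` on the first k and on the first k + 1 places.
  telescope : ∀ (A B F : ℕ → ℤ) n → (∀ i → F i ≡ A i ℤ.+ B i) →
    ∑ℤ n (telescopeTerm A B F n) ℤ.+ (∏[ i < n ] A (toℕ i))
      ≡ (∏[ i < n ] F (toℕ i))
  telescope A B F zero    F≡A+B = ≡.refl
  telescope A B F (suc n) F≡A+B
    rewrite ≡.sym (*-distribˡ-sumℤ {n} (A 0) (λ k → telescopeTerm (A ∘ suc) (B ∘ suc) (F ∘ suc) n (toℕ k))) | F≡A+B 0 = begin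
    B 0 ℤ.* ∏F ℤ.+ A 0 ℤ.* T ℤ.+ A 0 ℤ.* ∏A  ≡⟨ regroup (A 0) (B 0) T ∏F ∏A ⟩
    A 0 ℤ.* (T ℤ.+ ∏A) ℤ.+ B 0 ℤ.* ∏F        ≡⟨ ≡.cong (λ z → A 0 ℤ.* z ℤ.+ B 0 ℤ.* ∏F)
                                                  (telescope (A ∘ suc) (B ∘ suc) (F ∘ suc) n (F≡A+B ∘ suc)) ⟩
    A 0 ℤ.* ∏F ℤ.+ B 0 ℤ.* ∏F                ≡⟨ ℤP.*-distribʳ-+ ∏F (A 0) (B 0) ⟨
    (A 0 ℤ.+ B 0) ℤ.* ∏F                     ∎
    where
    T  = ∑ℤ n (telescopeTerm (A ∘ suc) (B ∘ suc) (F ∘ suc) n)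
    ∏A = ∏[ i < n ] A (suc (toℕ i))
    ∏F = ∏[ i < n ] F (suc (toℕ i))
    regroup : ∀ a b t f p → b ℤ.* f ℤ.+ a ℤ.* t ℤ.+ a ℤ.* p ≡ a ℤ.* (t ℤ.+ p) ℤ.+ b ℤ.* f
    regroup = solve-∀

  -- The scalar c is absorbed by the k-th factor alone. In the Pieri rule c is α_k - ρ_k + 1, the
  -- last entry of the descending list of row k.
  telescopeTerm-product : ∀ (A B F P : ℕ → ℤ) c {n k} → k ℕ.< n →
    (∀ i → i ℕ.< k → P i ≡ A i) → c ℤ.* P k ≡ B k → (∀ i → k ℕ.< i → P i ≡ F i) →
    c ℤ.* (∏[ i < n ] P (toℕ i)) ≡ telescopeTerm A B F n k
  telescopeTerm-product A B F P c {suc n} {zero} (s≤s _) below at above = begin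
    c ℤ.* (P 0 ℤ.* ∏P)  ≡⟨ ℤP.*-assoc c (P 0) ∏P ⟨
    c ℤ.* P 0 ℤ.* ∏P    ≡⟨ ≡.cong₂ ℤ._*_ at (sum-cong ℤP.*-1-monoid n (λ i → above (suc i) (s≤s z≤n))) ⟩
    B 0 ℤ.* ∏[ i < n ] F (suc (toℕ i)) ∎
    where ∏P = ∏[ i < n ] P (suc (toℕ i))
  telescopeTerm-product A B F P c {suc n} {suc k} (s≤s k<n) below at above = begin
    c ℤ.* (P 0 ℤ.* ∏P)  ≡⟨ swap c (P 0) ∏P ⟩
    P 0 ℤ.* (c ℤ.* ∏P)  ≡⟨ ≡.cong₂ ℤ._*_ (below 0 (s≤s z≤n))
                             (telescopeTerm-product (A ∘ suc) (B ∘ suc) (F ∘ suc) (P ∘ suc) c k<n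
                               (λ i i<k → below (suc i) (s≤s i<k)) at
                               (λ i k<i → above (suc i) (s≤s k<i))) ⟩
    _ ∎
    where
    ∏P = ∏[ i < n ] P (suc (toℕ i))
    swap : ∀ a b c → a ℤ.* (b ℤ.* c) ≡ b ℤ.* (a ℤ.* c)
    swap = solve-∀

  telescopeTerm-zero : ∀ (A B F : ℕ → ℤ) {n k} → B k ≡ 0ℤ → telescopeTerm A B F n k ≡ 0ℤ
  telescopeTerm-zero A B F {zero}          Bk≡0 = ≡.refl
  telescopeTerm-zero A B F {suc n} {zero}  Bk≡0 rewrite Bk≡0 = ≡.refl
  telescopeTerm-zero A B F {suc n} {suc k} Bk≡0
    rewrite telescopeTerm-zero (A ∘ suc) (B ∘ suc) (F ∘ suc) {n} {k} Bk≡0 = ℤP.*-zeroʳ (A 0)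

  -- Removing columns from a partition: the Pieri rule.

  E : ℤ → ℕ → ℕ → ℤ
  E a r d = elementary d (descending a r)

  -- Removing from ρ a column of height k + 1, that is, subtracting 1 from its first
  -- k + 1 parts, replaces the factors F i by A i for i < k, and F k by B k (up to
  -- the scalar in B).
  module Columns (a : ℕ → ℤ) (r : ℕ → ℕ) where
    F A B : ℕ → ℤ
    F i = E (a i) (r i) (r i ℕ.∸ r (suc i))
    A i = E (a i) (r i ℕ.∸ 1) (r i ℕ.∸ r (suc i))
    -- The test matters for equal rows: truncated subtraction would then give the degree 0, and e₀ =
    -- 1, although no column can be removed there and `B i` has to be 0.
    B i = if does (r (suc i) ℕP.<? r i)
          then (a i ℤ.- + r i ℤ.+ 1ℤ) ℤ.* E (a i) (r i ℕ.∸ 1) (r i ℕ.∸ 1 ℕ.∸ r (suc i))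
          else 0ℤ

    B≡0 : ∀ {i} → ¬ r (suc i) ℕ.< r i → B i ≡ 0ℤ
    B≡0 {i} rᵢ₊₁≮rᵢ rewrite dec-false (r (suc i) ℕP.<? r i) rᵢ₊₁≮rᵢ = ≡.refl

    F≡A+B : (∀ i → r (suc i) ℕ.≤ r i) → ∀ i → F i ≡ A i ℤ.+ B i
    F≡A+B decreasing i = split (r i) (r (suc i)) (decreasing i)
      where
      split : ∀ m s → s ℕ.≤ m → E (a i) m (m ℕ.∸ s) ≡ E (a i) (m ℕ.∸ 1) (m ℕ.∸ s) ℤ.+
        (if does (s ℕP.<? m)
         then (a i ℤ.- + m ℤ.+ 1ℤ) ℤ.* E (a i) (m ℕ.∸ 1) (m ℕ.∸ 1 ℕ.∸ s) else 0ℤ)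
      split zero .zero z≤n = ≡.refl
      split (suc m) s s≤1+m with s ℕP.<? suc m
      ... | yes (s≤s s≤m) rewrite dec-true (s ℕP.<? suc m) (s≤s s≤m) | ℕP.+-∸-assoc 1 s≤m =
            ≡.trans (elementary-snoc (λ j → a i ℤ.- + j) m (m ℕ.∸ s))
                    (≡.cong (λ z → E (a i) m (suc (m ℕ.∸ s)) ℤ.+ z ℤ.* E (a i) m (m ℕ.∸ s))
                      (shift (a i) (+ m)))
        where
        shift : ∀ x y → x ℤ.- y ≡ x ℤ.- (1ℤ ℤ.+ y) ℤ.+ 1ℤ
        shift = solve-∀
      ... | no s≮1+m rewrite dec-false (s ℕP.<? suc m) s≮1+m
                           | ℕP.m≤n⇒m∸n≡0 (ℕP.≮⇒≥ s≮1+m) = ≡.refl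

  -- Between r 0 > 0 and r n = 0 there is a positive row followed by a zero one, and the vanishing
  -- factor at that row kills the product.
  ∏-last-row : ∀ (G : ℕ → ℤ) (r : ℕ → ℕ) n → (∀ i → 0 ℕ.< r i → r (suc i) ≡ 0 → G i ≡ 0ℤ) →
               0 ℕ.< r 0 → r n ≡ 0 → (∏[ i < n ] G (toℕ i)) ≡ 0ℤ
  ∏-last-row G r zero    last 0<r₀ rₙ≡0 = contradiction (≡.subst (0 ℕ.<_) rₙ≡0 0<r₀) (λ ())
  ∏-last-row G r (suc n) last 0<r₀ rₙ≡0 with r 1 ℕP.≟ 0
  ... | yes r₁≡0 rewrite last 0 0<r₀ r₁≡0 = ≡.refl
  ... | no  r₁≢0 rewrite ∏-last-row (G ∘ suc) (r ∘ suc) n (last ∘ suc) (ℕP.n≢0⇒n>0 r₁≢0) rₙ≡0 =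
    ℤP.*-zeroʳ (G 0)

  -- In the last nonempty row, of length r, `A` is e_r of only r - 1 entries. This disposes of the
  -- product left over by `telescope`.
  ∏A≡0 : ∀ (a : ℕ → ℤ) (r : ℕ → ℕ) n → 0 ℕ.< r 0 → r n ≡ 0 →
         (∏[ i < n ] Columns.A a r (toℕ i)) ≡ 0ℤ
  ∏A≡0 a r n = ∏-last-row (Columns.A a r) r n last
    where
    last : ∀ i → 0 ℕ.< r i → r (suc i) ≡ 0 → Columns.A a r i ≡ 0ℤ
    last i 0<rᵢ rᵢ₊₁≡0 rewrite rᵢ₊₁≡0 =
      elementary-short (λ j → a i ℤ.- + j) (ℕP.≤-reflexive (ℕP.m+[n∸m]≡n 0<rᵢ))

  -- Extended by 0 to vectors that are not partitions, so that a Pieri sum may run over all columns,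
  -- removable or not.
  weight : Vector → Vector → ℤ
  weight α ρ = if does (isPartition? ρ) then partitionProduct α ρ else 0ℤ

  weight-partition : ∀ α {ρ} → IsPartition ρ → weight α ρ ≡ partitionProduct α ρ
  weight-partition α {ρ} p rewrite dec-true (isPartition? ρ) p = ≡.refl

  weight-nonpartition : ∀ α {ρ} → ¬ IsPartition ρ → weight α ρ ≡ 0ℤ
  weight-nonpartition α {ρ} ¬p rewrite dec-false (isPartition? ρ) ¬p = ≡.refl

  partitionFactor-trivial : ∀ α ρ i → bound ρ ℕ.≤ i → partitionFactor α ρ i ≡ 1ℤ
  partitionFactor-trivial α ρ i b≤i
    rewrite vanishes ρ i b≤i | vanishes ρ (suc i) (ℕP.m≤n⇒m≤1+n b≤i) = ≡.refl

  ones-< : ∀ {k i} → i ℕ.< k → entry (ones k) i ≡ 1ℤ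
  ones-< {k} {i} i<k = ≡.cong (if_then 1ℤ else 0ℤ) (dec-true (i ℕP.<? k) i<k)

  ones-≥ : ∀ {k i} → k ℕ.≤ i → entry (ones k) i ≡ 0ℤ
  ones-≥ {k} {i} = vanishes (ones k) i

  -- With β = α - ρ the scalar is the factor β_k + 1 of `derivativeTerm`; the sum over k is what the
  -- logarithms contribute to the coefficient of ℓ^{(n),β} in a derivative.
  pieriTerm : Vector → Vector → ℕ → ℤ
  pieriTerm α ρ k = (entry α k ℤ.- entry ρ k ℤ.+ 1ℤ) ℤ.* weight α (ρ -ᵥ ones (suc k))

  module _ (α ρ : Vector) (p : IsPartition ρ) where
    private
      r : ℕ → ℕ
      r i = ∣ entry ρ i ∣
      open Columns (entry α) r

    entry-nonneg : ∀ i → entry ρ i ≡ + r i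
    entry-nonneg i = ≡.sym (ℤP.0≤i⇒+∣i∣≡i (proj₁ (p i)))

    r-decreasing : ∀ i → r (suc i) ℕ.≤ r i
    r-decreasing i = ℤP.drop‿+≤+ (≡.subst₂ ℤ._≤_ (entry-nonneg (suc i)) (entry-nonneg i) (proj₂ (p i)))

    r-antitone : ∀ {i j} → i ℕ.≤ j → r j ℕ.≤ r i
    r-antitone {i} {j} i≤j = go (ℕP.≤⇒≤′ i≤j)
      where
      go : ∀ {j} → i ℕ.≤′ j → r j ℕ.≤ r i
      go ℕ.≤′-refl       = ℕP.≤-refl
      go (ℕ.≤′-step i≤j) = ℕP.≤-trans (r-decreasing _) (go i≤j)

    remove-≤ : ∀ {k i} → i ℕ.≤ k → entry (ρ -ᵥ ones (suc k)) i ≡ + r i ℤ.- 1ℤ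
    remove-≤ i≤k = ≡.cong₂ ℤ._-_ (entry-nonneg _) (ones-< (s≤s i≤k))

    remove-> : ∀ {k i} → k ℕ.< i → entry (ρ -ᵥ ones (suc k)) i ≡ + r i
    remove-> k<i = ≡.trans (≡.cong₂ ℤ._-_ (entry-nonneg _) (ones-≥ k<i)) (ℤP.+-identityʳ _)

    -- Only between rows k and k + 1 does the order become tighter, and there the strict inequality
    -- leaves room. The rows up to k are at least r k, hence positive before 1 is subtracted.
    remove-partition : ∀ {k} → r (suc k) ℕ.< r k → IsPartition (ρ -ᵥ ones (suc k))
    remove-partition {k} rₖ₊₁<rₖ i with ℕP.<-cmp i k
    ... | tri< i<k _ _ rewrite remove-≤ (ℕP.<⇒≤ i<k) | remove-≤ i<k =
          ℤP.i≤j⇒0≤j-i (ℤ.+≤+ 0<rᵢ) , ℤP.+-monoˡ-≤ -1ℤ (ℤ.+≤+ (r-decreasing i))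
      where
      0<rᵢ : 0 ℕ.< r i
      0<rᵢ = ℕP.<-≤-trans (ℕP.≤-<-trans z≤n rₖ₊₁<rₖ) (r-antitone (ℕP.<⇒≤ i<k))
    ... | tri≈ _ ≡.refl _ rewrite remove-≤ (ℕP.≤-refl {k}) | remove-> (ℕP.n<1+n k) =
          ℤP.i≤j⇒0≤j-i (ℤ.+≤+ (ℕP.≤-<-trans z≤n rₖ₊₁<rₖ)) ,
          ≡.subst (+ r (suc k) ℤ.≤_) (ℤP.+-comm -1ℤ (+ r k)) (ℤP.i<j⇒i≤pred[j] (ℤ.+<+ rₖ₊₁<rₖ))
    ... | tri> _ _ k<i rewrite remove-> k<i | remove-> (ℕP.m<n⇒m<1+n k<i) =
          ℤ.+≤+ z≤n , ℤ.+≤+ (r-decreasing i)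

    remove-nonpartition : ∀ {k} → ¬ r (suc k) ℕ.< r k → ¬ IsPartition (ρ -ᵥ ones (suc k))
    remove-nonpartition {k} rₖ₊₁≮rₖ q = rₖ₊₁≮rₖ (ℤP.drop‿+<+
      (ℤP.≤-<-trans (≡.subst₂ ℤ._≤_ (remove-> (ℕP.n<1+n k)) (remove-≤ ℕP.≤-refl) (proj₂ (q k)))
                    (ℤP.m⊖1+n<m (r k) 1)))

    -- If the column of height k + 1 is not removable, the left side vanishes by the definition of
    -- `weight` and the right side because `B k` is 0. Otherwise the products agree factor by
    -- factor.
    removeTerm : ∀ {k} → k ℕ.< bound ρ →
      pieriTerm α ρ k ≡ telescopeTerm A B F (bound ρ) k
    removeTerm {k} k<b with r (suc k) ℕP.<? r k
    ... | no rₖ₊₁≮rₖ = ≡.trans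
      (≡.trans (≡.cong (λ z → (entry α k ℤ.- entry ρ k ℤ.+ 1ℤ) ℤ.* z)
                 (weight-nonpartition α {ρ -ᵥ ones (suc k)} (remove-nonpartition rₖ₊₁≮rₖ)))
               (ℤP.*-zeroʳ (entry α k ℤ.- entry ρ k ℤ.+ 1ℤ)))
      (≡.sym (telescopeTerm-zero A B F {bound ρ} {k} (B≡0 rₖ₊₁≮rₖ)))
    ... | yes rₖ₊₁<rₖ = begin
      c ℤ.* weight α τ                               ≡⟨ ≡.cong (c ℤ.*_) (weight-partition α {τ} (remove-partition rₖ₊₁<rₖ)) ⟩
      -- The recorded bound of τ is a maximum; from `bound ρ` on its factors are 1.
      c ℤ.* partitionProduct α τ                     ≡⟨ ≡.cong (c ℤ.*_) (≡.sym (sum-extend ℤP.*-1-monoid (partitionFactor α τ) (ℕP.m≤m⊔n (bound ρ) (suc k))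
                                                          (λ i b≤i → ≡.trans (above i (ℕP.<-≤-trans k<b b≤i)) (partitionFactor-trivial α ρ i b≤i)))) ⟩
      c ℤ.* ∏[ i < bound ρ ] partitionFactor α τ (toℕ i) ≡⟨ telescopeTerm-product A B F (partitionFactor α τ) c k<b below at above ⟩
      telescopeTerm A B F (bound ρ) k                ∎
      where
      τ = ρ -ᵥ ones (suc k)
      c = entry α k ℤ.- entry ρ k ℤ.+ 1ℤ
      0<r : ∀ {i} → i ℕ.≤ k → 0 ℕ.< r i
      0<r i≤k = ℕP.<-≤-trans (ℕP.≤-<-trans z≤n rₖ₊₁<rₖ) (r-antitone i≤k)
      ∣m-1∣ : ∀ {m} → 0 ℕ.< m → ∣ + m ℤ.- 1ℤ ∣ ≡ m ℕ.∸ 1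
      ∣m-1∣ (s≤s _) = ≡.refl
      ∣remove∣-≤ : ∀ {i} → i ℕ.≤ k → ∣ entry τ i ∣ ≡ r i ℕ.∸ 1
      ∣remove∣-≤ {i} i≤k = ≡.trans (≡.cong ∣_∣ (remove-≤ i≤k)) (∣m-1∣ (0<r i≤k))
      ∣remove∣-> : ∀ {i} → k ℕ.< i → ∣ entry τ i ∣ ≡ r i
      ∣remove∣-> k<i = ≡.cong ∣_∣ (remove-> k<i)
      below : ∀ i → i ℕ.< k → partitionFactor α τ i ≡ A i
      below i i<k rewrite ∣remove∣-≤ (ℕP.<⇒≤ i<k) | ∣remove∣-≤ i<k =
        ≡.cong (E (entry α i) (r i ℕ.∸ 1))
          (≡.trans (ℕP.∸-+-assoc (r i) 1 (r (suc i) ℕ.∸ 1))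
                   (≡.cong (r i ℕ.∸_) (ℕP.m+[n∸m]≡n (0<r i<k))))
      at : c ℤ.* partitionFactor α τ k ≡ B k
      at rewrite ∣remove∣-≤ (ℕP.≤-refl {k}) | ∣remove∣-> (ℕP.n<1+n k) | dec-true (r (suc k) ℕP.<? r k) rₖ₊₁<rₖ | entry-nonneg k = ≡.refl
      above : ∀ i → k ℕ.< i → partitionFactor α τ i ≡ F i
      above i k<i rewrite ∣remove∣-> k<i | ∣remove∣-> (ℕP.m<n⇒m<1+n k<i) = ≡.refl

    -- The terms telescope to ∏ F - ∏ A, and ∏ A vanishes because ρ has a nonempty row.
    pieri-partition : 0ℤ ℤ.< entry ρ 0 →
      ∑ℤ (bound ρ) (pieriTerm α ρ)
        ≡ weight α ρ
    pieri-partition 0<ρ₀ = begin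
      ∑ℤ (bound ρ) (pieriTerm α ρ)          ≡⟨ sumℤ-cong {bound ρ} (λ k → removeTerm (FinP.toℕ<n k)) ⟩
      ∑telescope                       ≡⟨ ℤP.+-identityʳ ∑telescope ⟨
      ∑telescope ℤ.+ 0ℤ                ≡⟨ ≡.cong (λ z → ∑telescope ℤ.+ z) (∏A≡0 (entry α) r (bound ρ)
                                            (ℤP.drop‿+<+ (≡.subst (0ℤ ℤ.<_) (entry-nonneg 0) 0<ρ₀))
                                            (≡.cong ∣_∣ (vanishes ρ (bound ρ) ℕP.≤-refl))) ⟨
      ∑telescope ℤ.+ (∏[ i < bound ρ ] A (toℕ i)) ≡⟨ telescope A B F (bound ρ) (F≡A+B r-decreasing) ⟩
      partitionProduct α ρ             ≡⟨ weight-partition α {ρ} p ⟨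
      weight α ρ                       ∎
      where ∑telescope = ∑ℤ (bound ρ) (telescopeTerm A B F (bound ρ))

  ones-nonneg : ∀ k i → 0ℤ ℤ.≤ entry (ones k) i
  ones-nonneg k i with i ℕ.<ᵇ k
  ... | true  = ℤ.+≤+ z≤n
  ... | false = ℤ.+≤+ z≤n

  ones-decreasing : ∀ k i → entry (ones k) (suc i) ℤ.≤ entry (ones k) i
  ones-decreasing k i with suc i ℕP.<? k
  ... | yes 1+i<k rewrite ones-< 1+i<k | ones-< (ℕP.<-trans (ℕP.n<1+n i) 1+i<k) = ℤP.≤-refl
  ... | no  1+i≮k rewrite ones-≥ {k} {suc i} (ℕP.≮⇒≥ 1+i≮k) = ones-nonneg k i

  -ᵥ+ : ∀ ρ τ i → entry (ρ -ᵥ τ) i ℤ.+ entry τ i ≡ entry ρ i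
  -ᵥ+ ρ τ i = cancel (entry ρ i) (entry τ i)
    where
    cancel : ∀ x y → x ℤ.- y ℤ.+ y ≡ x
    cancel = solve-∀

  -- A sum of two partitions is a partition. In contrapositive form, removing a column never turns a
  -- non-partition into a partition, so that both sides of `pieri` vanish there.
  add-ones-partition : ∀ ρ k → IsPartition (ρ -ᵥ ones k) → IsPartition ρ
  add-ones-partition ρ k p i =
    ≡.subst (0ℤ ℤ.≤_) (-ᵥ+ ρ (ones k) i) (ℤP.+-mono-≤ (proj₁ (p i)) (ones-nonneg k i)) ,
    ≡.subst₂ ℤ._≤_ (-ᵥ+ ρ (ones k) (suc i)) (-ᵥ+ ρ (ones k) i)
      (ℤP.+-mono-≤ (proj₂ (p i)) (ones-decreasing k i))

  weight-remove-zero : ∀ α ρ k → ¬ 0ℤ ℤ.< entry ρ 0 → weight α (ρ -ᵥ ones (suc k)) ≡ 0ℤ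
  weight-remove-zero α ρ k ρ₀≯0 = weight-nonpartition α {ρ -ᵥ ones (suc k)} λ p →
    ρ₀≯0 (≡.subst (0ℤ ℤ.<_) (-ᵥ+ ρ (ones (suc k)) 0)
      (ℤP.+-mono-≤-< (proj₁ (p 0)) (ℤ.+<+ (s≤s z≤n))))

  pieri : ∀ α ρ → 0ℤ ℤ.< entry ρ 0 →
    ∑ℤ (bound ρ) (pieriTerm α ρ)
      ≡ weight α ρ
  pieri α ρ 0<ρ₀ with isPartition? ρ
  ... | yes p = pieri-partition α ρ p 0<ρ₀
  ... | no ¬p = ≡.trans
    (sum-zero ℤP.+-0-monoid (bound ρ)
      (pieriTerm α ρ)
      (λ k _ → ≡.trans
        (≡.cong ((entry α k ℤ.- entry ρ k ℤ.+ 1ℤ) ℤ.*_)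
          (weight-nonpartition α {ρ -ᵥ ones (suc k)} (¬p ∘ add-ones-partition ρ (suc k))))
        (ℤP.*-zeroʳ (entry α k ℤ.- entry ρ k ℤ.+ 1ℤ))))
    (≡.sym (weight-nonpartition α {ρ} ¬p))

  -- Special values of the weight.

  weight-cong : ∀ α {ρ τ} → ρ ≐ τ → weight α ρ ≡ weight α τ
  weight-cong α {ρ} {τ} e
    rewrite does-⇔ (isPartition? ρ) (isPartition? τ)
              (IsPartition-cong {ρ} {τ} e) (IsPartition-cong {τ} {ρ} (λ i → ≡.sym (e i)))
          | partitionProduct-cong α {ρ} {τ} e = ≡.refl

  weight-negative : ∀ α {ρ} → entry ρ 0 ℤ.< 0ℤ → weight α ρ ≡ 0ℤ
  weight-negative α {ρ} ρ₀<0 = weight-nonpartition α {ρ} (λ p → ℤP.<⇒≱ ρ₀<0 (proj₁ (p 0)))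

  weight-self : ∀ α → weight α (α -ᵥ α) ≡ 1ℤ
  weight-self α = weight-cong α {α -ᵥ α} {0ᵥ} (λ i → ℤP.+-inverseʳ (entry α i))

  -- The factors of the rows above k are e₀ = 1, and that of the row k is e₁(α_{k+1}).
  weight-ones : ∀ α k → weight α (ones (suc k)) ≡ entry α k
  weight-ones α k = ≡.trans
    (weight-partition α {ones (suc k)} (λ i → ones-nonneg (suc k) i , ones-decreasing (suc k) i))
    (product (partitionFactor α (ones (suc k))) k above last)
    where
    above : ∀ i → i ℕ.< k → partitionFactor α (ones (suc k)) i ≡ 1ℤ
    above i i<k rewrite ones-< (ℕP.m<n⇒m<1+n i<k) | ones-< (s≤s i<k) = ≡.refl
    last : partitionFactor α (ones (suc k)) k ≡ entry α k
    last rewrite ones-< (ℕP.n<1+n k) | ones-≥ (ℕP.≤-refl {suc k}) = simplify (entry α k)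
      where
      simplify : ∀ x → (x ℤ.- 0ℤ) ℤ.* 1ℤ ℤ.+ 0ℤ ≡ x
      simplify = solve-∀
    product : ∀ (P : ℕ → ℤ) k {x} → (∀ i → i ℕ.< k → P i ≡ 1ℤ) → P k ≡ x →
              (∏[ i < suc k ] P (toℕ i)) ≡ x
    product P zero    above last = ≡.trans (ℤP.*-identityʳ (P 0)) last
    product P (suc k) above last =
      ≡.trans (≡.cong₂ ℤ._*_ (above 0 (s≤s z≤n)) (product (P ∘ suc) k (λ i i<k → above (suc i) (s≤s i<k)) last))
              (ℤP.*-identityˡ _)

  -- The factor of the last row is e_r(0,-1,…,-r+1) = 0.
  weight-0ᵥ-positive : ∀ {α ρ} → α ≐ 0ᵥ → 0ℤ ℤ.< entry ρ 0 → weight α ρ ≡ 0ℤ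
  weight-0ᵥ-positive {α} {ρ} α≐0 0<ρ₀ with isPartition? ρ
  ... | no ¬p = weight-nonpartition α {ρ} ¬p
  ... | yes p = ≡.trans (weight-partition α {ρ} p)
    (∏-last-row (partitionFactor α ρ) (λ i → ∣ entry ρ i ∣) (bound ρ) last
      (positive 0<ρ₀) (≡.cong ∣_∣ (vanishes ρ (bound ρ) ℕP.≤-refl)))
    where
    positive : ∀ {x} → 0ℤ ℤ.< x → 0 ℕ.< ∣ x ∣
    positive (ℤ.+<+ 0<n) = 0<n
    E-zero : ∀ r → 0 ℕ.< r → E 0ℤ r r ≡ 0ℤ
    E-zero (suc r) _ = ≡.trans (ℤP.+-identityˡ _) (elementary-short (λ j → 0ℤ ℤ.- + suc j) (ℕP.n<1+n r))
    last : ∀ i → 0 ℕ.< ∣ entry ρ i ∣ → ∣ entry ρ (suc i) ∣ ≡ 0 → partitionFactor α ρ i ≡ 0ℤ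
    last i 0<rᵢ rᵢ₊₁≡0 rewrite rᵢ₊₁≡0 | α≐0 i = E-zero ∣ entry ρ i ∣ 0<rᵢ

  -- For α = (0) only ρ = 0 contributes, so λ_n^{(0)} is a multiple of x^n. In the middle case, a
  -- partition with first part 0 is the zero vector.
  weight-0ᵥ : ∀ {α ρ} → α ≐ 0ᵥ → ¬ ρ ≐ 0ᵥ → weight α ρ ≡ 0ℤ
  weight-0ᵥ {α} {ρ} α≐0 ρ≢0 with ℤP.<-cmp 0ℤ (entry ρ 0)
  ... | tri< 0<ρ₀ _ _ = weight-0ᵥ-positive {α} {ρ} α≐0 0<ρ₀
  ... | tri> _ _ ρ₀<0 = weight-negative α {ρ} ρ₀<0
  ... | tri≈ _ 0≡ρ₀ _ = weight-nonpartition α {ρ} λ p → ρ≢0 λ i →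
    ≡.trans (entry-nonneg α ρ p i) (≡.cong +_ (ℕP.n≤0⇒n≡0
      (≡.subst (∣ entry ρ i ∣ ℕ.≤_) (≡.cong ∣_∣ (≡.sym 0≡ρ₀)) (r-antitone α ρ p z≤n))))

open Partitions

module Logarithmic {c ℓ₁ ℓ₂} (K : HeytingField c ℓ₁ ℓ₂) (char0 : CharacteristicZero K) where
  open LogarithmicAlgebra K char0
  open HeytingField K
  open CommutativeRing (HeytingCommutativeRing.commutativeRing heytingCommutativeRing)
    using (semiring; commutativeSemiring; ring; +-abelianGroup; +-monoid)
  open SemiringMult semiring using (×-homo-+; ×-assoc-*; ×-congʳ; ×1-homo-*) renaming (_×_ to _·_)
  open SemiringSum semiring
    using (sum-syntax; sum-cong-≋; ∑-distrib-+; ∑-comm; *-distribˡ-sum; *-distribʳ-sum)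
  open RingProperties ring using (-‿distribˡ-*; -0#≈0#; -‿involutive)
  open AbelianGroupProperties +-abelianGroup using (⁻¹-∙-comm)
  open HeytingProperties heytingCommutativeRing
    using (1#0; x-0≈x; invertibleʳ⇒#; x#0y#0→xy#0; #-congʳ)
  open SetoidReasoning setoid
  open SemiringSolver commutativeSemiring using (solve; _:=_; _:+_; _:*_; con)

  -- Field arithmetic and the image of the integers.

  recip-inverseˡ : ∀ {x} (x#0 : x # 0#) → recip x#0 * x ≈ 1#
  recip-inverseˡ {x} x#0 =
    trans (*-congˡ (sym (x-0≈x x))) (proj₁ (proj₂ (#⇒invertible x#0)))

  recip-inverseʳ : ∀ {x} (x#0 : x # 0#) → x * recip x#0 ≈ 1#
  recip-inverseʳ x#0 = trans (*-comm _ _) (recip-inverseˡ x#0)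

  *-cancelˡ : ∀ {x y z} → x # 0# → x * y ≈ x * z → y ≈ z
  *-cancelˡ {x} {y} {z} x#0 xy≈xz = begin
    y                    ≈⟨ undo y ⟨
    recip x#0 * (x * y)  ≈⟨ *-congˡ xy≈xz ⟩
    recip x#0 * (x * z)  ≈⟨ undo z ⟩
    z                    ∎
    where
    undo : ∀ w → recip x#0 * (x * w) ≈ w
    undo w = trans (sym (*-assoc _ x w)) (trans (*-congʳ (recip-inverseˡ x#0)) (*-identityˡ w))

  *-cancelʳ : ∀ {x y z} → x # 0# → y * x ≈ z * x → y ≈ z
  *-cancelʳ x#0 yx≈zx = *-cancelˡ x#0 (trans (*-comm _ _) (trans yx≈zx (*-comm _ _)))

  recip#0 : ∀ {x} (x#0 : x # 0#) → recip x#0 # 0#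
  recip#0 {x} x#0 = invertibleʳ⇒# (x , trans (*-congʳ (x-0≈x _)) (recip-inverseˡ x#0))

  +-cancelʳ : ∀ {x y z} → y + x ≈ z + x → y ≈ z
  +-cancelʳ {x} {y} {z} e = begin
    y            ≈⟨ undo y ⟨
    y + x + - x  ≈⟨ +-congʳ e ⟩
    z + x + - x  ≈⟨ undo z ⟩
    z            ∎
    where
    undo : ∀ w → w + x + - x ≈ w
    undo w = trans (+-assoc w x _) (trans (+-congˡ (-‿inverseʳ x)) (+-identityʳ w))

  neg#0 : ∀ {x} → x # 0# → - x # 0#
  neg#0 {x} x#0 = invertibleʳ⇒# (- recip x#0 , (begin
    (- x - 0#) * - recip x#0  ≈⟨ *-congʳ (x-0≈x _) ⟩
    - x * - recip x#0         ≈⟨ -‿distribˡ-* x _ ⟨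
    - (x * - recip x#0)       ≈⟨ -‿cong (*-comm x _) ⟩
    - (- recip x#0 * x)       ≈⟨ -‿cong (-‿distribˡ-* _ x) ⟨
    - - (recip x#0 * x)       ≈⟨ -‿involutive _ ⟩
    recip x#0 * x             ≈⟨ recip-inverseˡ x#0 ⟩
    1#                        ∎))

  fromℤ-neg : ∀ i → fromℤ (ℤ.- i) ≈ - fromℤ i
  fromℤ-neg (+ zero)  = sym -0#≈0#
  fromℤ-neg (+ suc n) = refl
  fromℤ-neg -[1+ n ]  = sym (-‿involutive _)

  fromℤ-⊖ : ∀ m n → fromℤ (m ℤ.⊖ n) ≈ m · 1# + - (n · 1#)
  fromℤ-⊖ m       zero    = sym (x-0≈x _)
  fromℤ-⊖ zero    (suc n) = sym (+-identityˡ _)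
  fromℤ-⊖ (suc m) (suc n) = begin
    fromℤ (suc m ℤ.⊖ suc n)              ≡⟨ ≡.cong fromℤ (ℤP.[1+m]⊖[1+n]≡m⊖n m n) ⟩
    fromℤ (m ℤ.⊖ n)                      ≈⟨ fromℤ-⊖ m n ⟩
    M + - N                              ≈⟨ +-identityˡ _ ⟨
    0# + (M + - N)                       ≈⟨ +-congʳ (-‿inverseʳ 1#) ⟨
    1# + - 1# + (M + - N)                ≈⟨ solve 4 (λ p q r s → p :+ q :+ (r :+ s) := p :+ r :+ (q :+ s)) refl 1# (- 1#) M (- N) ⟩
    1# + M + (- 1# + - N)                ≈⟨ +-congˡ (⁻¹-∙-comm 1# N) ⟩
    1# + M + - (1# + N)                  ∎
    where
    M = m · 1#
    N = n · 1#

  fromℤ-+ : ∀ i j → fromℤ (i ℤ.+ j) ≈ fromℤ i + fromℤ j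
  fromℤ-+ (+ m)    (+ n)    = ×-homo-+ 1# m n
  fromℤ-+ (+ m)    -[1+ n ] = fromℤ-⊖ m (suc n)
  fromℤ-+ -[1+ m ] (+ n)    = trans (fromℤ-⊖ n (suc m)) (+-comm _ _)
  fromℤ-+ -[1+ m ] -[1+ n ] = begin
    - (suc (suc (m ℕ.+ n)) · 1#)         ≡⟨ ≡.cong (λ k → - (k · 1#)) (ℕP.+-suc (suc m) n) ⟨
    - ((suc m ℕ.+ suc n) · 1#)           ≈⟨ -‿cong (×-homo-+ 1# (suc m) (suc n)) ⟩
    - (suc m · 1# + suc n · 1#)          ≈⟨ ⁻¹-∙-comm _ _ ⟨
    - (suc m · 1#) + - (suc n · 1#)      ∎

  fromℤ-1 : fromℤ 1ℤ ≈ 1#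
  fromℤ-1 = +-identityʳ 1#

  fromℤ-* : ∀ i j → fromℤ (i ℤ.* j) ≈ fromℤ i * fromℤ j
  fromℤ-* (+ n) j = natural n
    where
    natural : ∀ n → fromℤ (+ n ℤ.* j) ≈ fromℤ (+ n) * fromℤ j
    natural zero    = sym (zeroˡ _)
    natural (suc n) = begin
      fromℤ (+ suc n ℤ.* j)                   ≡⟨ ≡.cong fromℤ (ℤP.suc-* (+ n) j) ⟩
      fromℤ (j ℤ.+ + n ℤ.* j)                 ≈⟨ fromℤ-+ j (+ n ℤ.* j) ⟩
      fromℤ j + fromℤ (+ n ℤ.* j)             ≈⟨ +-cong (sym (*-identityˡ _)) (natural n) ⟩
      1# * fromℤ j + fromℤ (+ n) * fromℤ j    ≈⟨ distribʳ _ _ _ ⟨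
      fromℤ (+ suc n) * fromℤ j               ∎
  fromℤ-* -[1+ n ] j = begin
    fromℤ (-[1+ n ] ℤ.* j)             ≡⟨ ≡.cong fromℤ (ℤP.neg-distribˡ-* (+ suc n) j) ⟨
    fromℤ (ℤ.- (+ suc n ℤ.* j))        ≈⟨ fromℤ-neg (+ suc n ℤ.* j) ⟩
    - fromℤ (+ suc n ℤ.* j)            ≈⟨ -‿cong (fromℤ-* (+ suc n) j) ⟩
    - (fromℤ (+ suc n) * fromℤ j)      ≈⟨ -‿distribˡ-* _ _ ⟩
    - fromℤ (+ suc n) * fromℤ j        ∎

  fromℤ#0 : ∀ i → i ≡.≢ 0ℤ → fromℤ i # 0#
  fromℤ#0 (+ zero)  i≢0 with () ← i≢0 ≡.refl
  fromℤ#0 (+ suc n) i≢0 = char0 (suc n)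
  fromℤ#0 -[1+ n ]  i≢0 = neg#0 (char0 (suc n))

  -- The semiring of power series.

  infix 4 _≈ₛ_
  _≈ₛ_ : PowerSeries → PowerSeries → Set ℓ₁
  a ≈ₛ b = ∀ n → a n ≈ b n

  infixl 6 _+ₛ_
  _+ₛ_ : PowerSeries → PowerSeries → PowerSeries
  (a +ₛ b) n = a n + b n

  0ₛ : PowerSeries
  0ₛ _ = 0#

  infixr 8 _∙ₛ_
  _∙ₛ_ : Carrier → PowerSeries → PowerSeries
  (x ∙ₛ a) n = x * a n

  tail : PowerSeries → PowerSeries
  tail a n = a (suc n)

  ⊛-cong : ∀ {a b u v} → a ≈ₛ b → u ≈ₛ v → a ⊛ u ≈ₛ b ⊛ v
  ⊛-cong a≈b u≈v n = sum-cong-≋ {suc n} (λ i → *-cong (a≈b (toℕ i)) (u≈v (n ℕ.∸ toℕ i)))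

  ⊛-congˡ : ∀ a {u v} → u ≈ₛ v → a ⊛ u ≈ₛ a ⊛ v
  ⊛-congˡ a = ⊛-cong {a} {a} (λ _ → refl)

  ⊛-congʳ : ∀ u {a b} → a ≈ₛ b → a ⊛ u ≈ₛ b ⊛ u
  ⊛-congʳ u a≈b = ⊛-cong a≈b (λ _ → refl {u _})

  ⊛-distribʳ : ∀ u a b → (a +ₛ b) ⊛ u ≈ₛ a ⊛ u +ₛ b ⊛ u
  ⊛-distribʳ u a b n = trans
    (sum-cong-≋ {suc n} (λ i → distribʳ (u (n ℕ.∸ toℕ i)) (a (toℕ i)) (b (toℕ i))))
    (∑-distrib-+ {suc n} (λ i → a (toℕ i) * u (n ℕ.∸ toℕ i)) (λ i → b (toℕ i) * u (n ℕ.∸ toℕ i)))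

  ∙ₛ-⊛ : ∀ x a u → (x ∙ₛ a) ⊛ u ≈ₛ x ∙ₛ (a ⊛ u)
  ∙ₛ-⊛ x a u n = trans
    (sum-cong-≋ {suc n} (λ i → *-assoc x (a (toℕ i)) (u (n ℕ.∸ toℕ i))))
    (sym (*-distribˡ-sum {suc n} x (λ i → a (toℕ i) * u (n ℕ.∸ toℕ i))))

  -- Computation splits off the summand with `a 0`; this splits off the opposite end, with `b 0`, as
  -- commutativity requires.
  ⊛-suc : ∀ a b n → (a ⊛ b) (suc n) ≈ (a ⊛ tail b) n + a (suc n) * b 0
  ⊛-suc a b zero    =
    solve 2 (λ p q → p :+ (q :+ con 0) := p :+ con 0 :+ q) refl (a 0 * b 1) (a 1 * b 0)
  ⊛-suc a b (suc n) = trans (+-congˡ (⊛-suc (tail a) b n)) (sym (+-assoc _ _ _))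

  ⊛-comm : ∀ a b → a ⊛ b ≈ₛ b ⊛ a
  ⊛-comm a b zero    = +-congʳ (*-comm _ _)
  ⊛-comm a b (suc n) = begin
    a 0 * b (suc n) + (tail a ⊛ b) n  ≈⟨ +-comm _ _ ⟩
    (tail a ⊛ b) n + a 0 * b (suc n)  ≈⟨ +-cong (⊛-comm (tail a) b n) (*-comm _ _) ⟩
    (b ⊛ tail a) n + b (suc n) * a 0  ≈⟨ ⊛-suc b a n ⟨
    (b ⊛ a) (suc n)                   ∎

  ⊛-assoc : ∀ a b d → (a ⊛ b) ⊛ d ≈ₛ a ⊛ (b ⊛ d)
  ⊛-assoc a b d zero    =
    solve 3 (λ x y z → (x :* y :+ con 0) :* z :+ con 0 := x :* (y :* z :+ con 0) :+ con 0)
          refl (a 0) (b 0) (d 0)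
  ⊛-assoc a b d (suc n) = begin
    (a 0 * b 0 + 0#) * d (suc n) + ((a 0 ∙ₛ tail b +ₛ tail a ⊛ b) ⊛ d) n
      ≈⟨ +-congˡ (trans (⊛-distribʳ d (a 0 ∙ₛ tail b) (tail a ⊛ b) n)
                        (+-cong (∙ₛ-⊛ (a 0) (tail b) d n) (⊛-assoc (tail a) b d n))) ⟩
    (a 0 * b 0 + 0#) * d (suc n) + (a 0 * (tail b ⊛ d) n + (tail a ⊛ (b ⊛ d)) n)
      ≈⟨ solve 5 (λ x y z v w → (x :* y :+ con 0) :* z :+ (x :* v :+ w) := x :* (y :* z :+ v) :+ w)
               refl (a 0) (b 0) (d (suc n)) ((tail b ⊛ d) n) ((tail a ⊛ (b ⊛ d)) n) ⟩
    a 0 * (b ⊛ d) (suc n) + (tail a ⊛ (b ⊛ d)) n ∎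

  ⊛-zeroˡ : ∀ a → 0ₛ ⊛ a ≈ₛ 0ₛ
  ⊛-zeroˡ a n = sum-zero +-monoid (suc n) (λ i → 0# * a (n ℕ.∸ i)) (λ i _ → zeroˡ _)

  ⊛-identityˡ : ∀ a → one ⊛ a ≈ₛ a
  ⊛-identityˡ a zero    = trans (+-identityʳ _) (*-identityˡ _)
  ⊛-identityˡ a (suc n) = trans (+-cong (*-identityˡ _) (⊛-zeroˡ a n)) (+-identityʳ _)

  powerSeriesSemiring : CommutativeSemiring c ℓ₁
  powerSeriesSemiring = record
    { Carrier = PowerSeries
    ; _≈_ = _≈ₛ_
    ; _+_ = _+ₛ_
    ; _*_ = _⊛_
    ; 0# = 0ₛ
    ; 1# = one
    ; isCommutativeSemiring = Biased.isCommutativeSemiringˡ record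
      { +-isCommutativeMonoid = record
        { isMonoid = record
          { isSemigroup = record
            { isMagma = record
              { isEquivalence = ≈ₛ-isEquivalence
              ; ∙-cong = λ a≈b u≈v n → +-cong (a≈b n) (u≈v n)
              }
            ; assoc = λ a b d n → +-assoc _ _ _
            }
          ; identity = (λ a n → +-identityˡ _) , (λ a n → +-identityʳ _)
          }
        ; comm = λ a b n → +-comm _ _
        }
      ; *-isCommutativeMonoid = record
        { isMonoid = record
          { isSemigroup = record
            { isMagma = record { isEquivalence = ≈ₛ-isEquivalence ; ∙-cong = ⊛-cong }
            ; assoc = ⊛-assoc
            }
          ; identity = ⊛-identityˡ , (λ a n → trans (⊛-comm a one n) (⊛-identityˡ a n))
          }
        ; comm = ⊛-comm
        }
      ; distribʳ = ⊛-distribʳ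
      ; zeroˡ = ⊛-zeroˡ
      }
    }
    where
    ≈ₛ-isEquivalence : IsEquivalence _≈ₛ_
    ≈ₛ-isEquivalence = record
      { refl = λ n → refl ; sym = λ e n → sym (e n) ; trans = λ e e′ n → trans (e n) (e′ n) }

  module S = CommutativeSemiring powerSeriesSemiring

  ⊛-∙ₛ : ∀ x a u → a ⊛ (x ∙ₛ u) ≈ₛ x ∙ₛ (a ⊛ u)
  ⊛-∙ₛ x a u n = trans (⊛-comm a (x ∙ₛ u) n) (trans (∙ₛ-⊛ x u a n) (*-congˡ (⊛-comm u a n)))

  -- A series without constant term has order at least 1, so its k-th power has order at least k.
  -- This makes the geometric series finite in each degree.
  ^-vanishes : ∀ {u} → u 0 ≈ 0# → ∀ {n k} → n ℕ.< k → (u ^ k) n ≈ 0#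
  ^-vanishes {u} u₀≈0 {zero}  {suc k} _ =
    trans (+-identityʳ _) (trans (*-congʳ u₀≈0) (zeroˡ _))
  ^-vanishes {u} u₀≈0 {suc n} {suc k} (s≤s n<k) = trans
    (+-cong (trans (*-congʳ u₀≈0) (zeroˡ _))
            (sum-zero +-monoid (suc n) (λ i → u (suc i) * (u ^ k) (n ℕ.∸ i))
              (λ i _ → trans (*-congˡ (^-vanishes u₀≈0 (ℕP.≤-<-trans (ℕP.m∸n≤m n i) n<k))) (zeroʳ _))))
    (+-identityˡ 0#)

  -- The series 1/(1 - u) when u has no constant term; `inverse` is a scalar multiple of it.
  geometric : PowerSeries → PowerSeries
  geometric u n = ∑[ k < suc n ] (u ^ toℕ k) n

  geometric-extend : ∀ {u} → u 0 ≈ 0# → ∀ {m n} → m ℕ.≤ n →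
                     geometric u m ≈ ∑[ k < suc n ] (u ^ toℕ k) m
  geometric-extend {u} u₀≈0 {m} m≤n =
    sum-extend +-monoid (λ k → (u ^ k) m) (s≤s m≤n) (λ k → ^-vanishes u₀≈0)

  -- The cutoff of the geometric sum depends on the degree, so all coefficients are extended to the
  -- range `suc n` before the two sums are exchanged; the added powers vanish.
  geometric-step : ∀ {u} → u 0 ≈ 0# → geometric u ≈ₛ one +ₛ u ⊛ geometric u
  geometric-step {u} u₀≈0 n = +-congˡ (begin
    ∑[ k < n ] (u ^ suc (toℕ k)) n
      ≈⟨ sum-extend +-monoid (λ k → (u ^ suc k) n) (ℕP.n≤1+n n) (λ k n≤k → ^-vanishes u₀≈0 (s≤s n≤k)) ⟩
    ∑[ k < suc n ] (u ^ suc (toℕ k)) n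
      ≈⟨ ∑-comm {suc n} {suc n} (λ k i → u (toℕ i) * (u ^ toℕ k) (n ℕ.∸ toℕ i)) ⟩
    ∑[ i < suc n ] ∑[ k < suc n ] (u (toℕ i) * (u ^ toℕ k) (n ℕ.∸ toℕ i))
      ≈⟨ sum-cong-≋ {suc n} (λ i → trans
           (sym (*-distribˡ-sum {suc n} (u (toℕ i)) (λ k → (u ^ toℕ k) (n ℕ.∸ toℕ i))))
           (*-congˡ (sym (geometric-extend u₀≈0 (ℕP.m∸n≤m n (toℕ i)))))) ⟩
    (u ⊛ geometric u) n ∎)

  -- Since r a + u = 1 and s = 1 + u s, adding u s to a (r s) gives s = 1 + u s, from which u s is
  -- cancelled.
  ⊛-inverseʳ : ∀ a (a₀#0 : a 0 # 0#) → a ⊛ inverse a a₀#0 ≈ₛ one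
  ⊛-inverseʳ a a₀#0 n = +-cancelʳ (begin
    (a ⊛ (r ∙ₛ s)) n + (u ⊛ s) n   ≈⟨ +-congʳ (trans (⊛-∙ₛ r a s n) (sym (∙ₛ-⊛ r a s n))) ⟩
    ((r ∙ₛ a) ⊛ s) n + (u ⊛ s) n   ≈⟨ ⊛-distribʳ s (r ∙ₛ a) u n ⟨
    ((r ∙ₛ a +ₛ u) ⊛ s) n          ≈⟨ ⊛-congʳ s complement n ⟩
    (one ⊛ s) n                    ≈⟨ ⊛-identityˡ s n ⟩
    s n                            ≈⟨ geometric-step u₀≈0 n ⟩
    one n + (u ⊛ s) n              ∎)
    where
    r = recip a₀#0
    u : PowerSeries
    u i = one i - r * a i
    s = geometric u
    u₀≈0 : u 0 ≈ 0#
    u₀≈0 = trans (+-congˡ (-‿cong (recip-inverseˡ a₀#0))) (-‿inverseʳ 1#)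
    complement : r ∙ₛ a +ₛ u ≈ₛ one
    complement i = begin
      r * a i + (one i - r * a i)    ≈⟨ solve 3 (λ x y z → x :+ (y :+ z) := y :+ (x :+ z)) refl
                                          (r * a i) (one i) (- (r * a i)) ⟩
      one i + (r * a i - r * a i)    ≈⟨ +-congˡ (-‿inverseʳ _) ⟩
      one i + 0#                     ≈⟨ +-identityʳ _ ⟩
      one i                          ∎

  -- The derivation θ and the residue identity.

  θ : PowerSeries → PowerSeries
  θ a n = fromℤ (+ n) * a n

  θ-cong : ∀ {a b} → a ≈ₛ b → θ a ≈ₛ θ b
  θ-cong a≈b n = *-congˡ (a≈b n)

  θ-one : θ one ≈ₛ 0ₛ
  θ-one zero    = zeroˡ _
  θ-one (suc n) = zeroʳ _

  θ-⊛ : ∀ a b → θ (a ⊛ b) ≈ₛ θ a ⊛ b +ₛ a ⊛ θ b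
  θ-⊛ a b n = begin
    fromℤ (+ n) * (a ⊛ b) n
      ≈⟨ *-distribˡ-sum {suc n} (fromℤ (+ n)) (λ i → a (toℕ i) * b (n ℕ.∸ toℕ i)) ⟩
    ∑[ i < suc n ] (fromℤ (+ n) * (a (toℕ i) * b (n ℕ.∸ toℕ i)))
      ≈⟨ sum-cong-≋ {suc n} (λ i → term (toℕ i) (ℕP.≤-pred (FinP.toℕ<n i))) ⟩
    ∑[ i < suc n ] (θ a (toℕ i) * b (n ℕ.∸ toℕ i) + a (toℕ i) * θ b (n ℕ.∸ toℕ i))
      ≈⟨ ∑-distrib-+ {suc n} (λ i → θ a (toℕ i) * b (n ℕ.∸ toℕ i)) (λ i → a (toℕ i) * θ b (n ℕ.∸ toℕ i)) ⟩
    (θ a ⊛ b) n + (a ⊛ θ b) n ∎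
    where
    term : ∀ i → i ℕ.≤ n →
      fromℤ (+ n) * (a i * b (n ℕ.∸ i)) ≈ θ a i * b (n ℕ.∸ i) + a i * θ b (n ℕ.∸ i)
    term i i≤n = begin
      fromℤ (+ n) * (a i * b (n ℕ.∸ i))
        ≡⟨ ≡.cong (λ m → fromℤ (+ m) * (a i * b (n ℕ.∸ i))) (ℕP.m+[n∸m]≡n i≤n) ⟨
      fromℤ (+ (i ℕ.+ (n ℕ.∸ i))) * (a i * b (n ℕ.∸ i))
        ≈⟨ *-congʳ (×-homo-+ 1# i (n ℕ.∸ i)) ⟩
      (fromℤ (+ i) + fromℤ (+ (n ℕ.∸ i))) * (a i * b (n ℕ.∸ i))
        ≈⟨ solve 4 (λ p q x y → (p :+ q) :* (x :* y) := p :* x :* y :+ x :* (q :* y)) refl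
             (fromℤ (+ i)) (fromℤ (+ (n ℕ.∸ i))) (a i) (b (n ℕ.∸ i)) ⟩
      θ a i * b (n ℕ.∸ i) + a i * θ b (n ℕ.∸ i) ∎

  derivative-θ : ∀ {a b} → tail a ≈ₛ b → derivative a ≈ₛ b +ₛ θ b
  derivative-θ {a} {b} e n = begin
    a (suc n) + n · a (suc n)      ≈⟨ +-cong (e n) (×-congʳ n (trans (e n) (sym (*-identityˡ _)))) ⟩
    b n + n · (1# * b n)           ≈⟨ +-congˡ (×-assoc-* n 1# (b n)) ⟨
    b n + θ b n                    ∎

  module _ (a : PowerSeries) (a₀#0 : a 0 # 0#) where
    private
      z : ℤ → PowerSeries
      z = zpower a a₀#0

    ⊛-cancelˡ : ∀ {u v} → a ⊛ u ≈ₛ a ⊛ v → u ≈ₛ v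
    ⊛-cancelˡ {u} {v} e = S.trans (S.sym (undo u)) (S.trans (⊛-congˡ a⁻¹ e) (undo v))
      where
      a⁻¹ = inverse a a₀#0
      undo : ∀ w → a⁻¹ ⊛ (a ⊛ w) ≈ₛ w
      undo w = S.trans (S.sym (⊛-assoc a⁻¹ a w))
        (S.trans (⊛-congʳ w (S.trans (⊛-comm a⁻¹ a) (⊛-inverseʳ a a₀#0))) (⊛-identityˡ w))

    -- One law for all integer exponents; at n = 0 it crosses from the powers of a to those of its
    -- inverse.
    zpower-pred : ∀ n → a ⊛ z (ℤ.pred n) ≈ₛ z n
    zpower-pred (+ zero)  = S.trans (⊛-congˡ a (S.*-identityʳ (inverse a a₀#0))) (⊛-inverseʳ a a₀#0)
    zpower-pred (+ suc n) = S.refl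
    zpower-pred -[1+ n ]  = S.trans (S.sym (⊛-assoc a v (z -[1+ n ])))
      (S.trans (⊛-congʳ (z -[1+ n ]) (⊛-inverseʳ a a₀#0)) (⊛-identityˡ (z -[1+ n ])))
      where v = inverse a a₀#0

    ⊛-swap : ∀ b n → a ⊛ (b ⊛ z (ℤ.pred n)) ≈ₛ b ⊛ z n
    ⊛-swap b n = S.trans (swap a b (z (ℤ.pred n))) (⊛-congˡ b (zpower-pred n))
      where
      swap : ∀ a b d → a ⊛ (b ⊛ d) ≈ₛ b ⊛ (a ⊛ d)
      swap a b d = S.trans (S.sym (⊛-assoc a b d)) (S.trans (⊛-congʳ d (⊛-comm a b)) (⊛-assoc b a d))

    -- Applying θ to a a^{n-1} = a^n gives a θ(a^{n-1}) = (n - 1) θa a^{n-1}, and a is cancelled.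
    -- This carries the power rule from 0 down to every negative exponent.
    θ-zpower-pred : ∀ n → θ (z n) ≈ₛ fromℤ n ∙ₛ (θ a ⊛ z (ℤ.pred n)) →
      θ (z (ℤ.pred n)) ≈ₛ fromℤ (ℤ.pred n) ∙ₛ (θ a ⊛ z (ℤ.pred (ℤ.pred n)))
    θ-zpower-pred n hyp = ⊛-cancelˡ λ j → +-cancelʳ (begin
      (a ⊛ θ (z (ℤ.pred n))) j + X j      ≈⟨ +-comm _ _ ⟩
      X j + (a ⊛ θ (z (ℤ.pred n))) j      ≈⟨ θ-⊛ a (z (ℤ.pred n)) j ⟨
      θ (a ⊛ z (ℤ.pred n)) j              ≈⟨ θ-cong (zpower-pred n) j ⟩
      θ (z n) j                           ≈⟨ hyp j ⟩
      fromℤ n * X j                       ≡⟨ ≡.cong (λ i → fromℤ i * X j) (pred+1 n) ⟩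
      fromℤ (ℤ.pred n ℤ.+ 1ℤ) * X j       ≈⟨ *-congʳ (fromℤ-+ (ℤ.pred n) 1ℤ) ⟩
      (fromℤ (ℤ.pred n) + fromℤ 1ℤ) * X j ≈⟨ trans (*-congʳ (+-congˡ fromℤ-1)) (trans (distribʳ _ _ _) (+-congˡ (*-identityˡ _))) ⟩
      fromℤ (ℤ.pred n) * X j + X j        ≈⟨ +-congʳ (trans (⊛-∙ₛ (fromℤ (ℤ.pred n)) a (θ a ⊛ z (ℤ.pred (ℤ.pred n))) j)
                                                            (*-congˡ (⊛-swap (θ a) (ℤ.pred n) j))) ⟨
      (a ⊛ (fromℤ (ℤ.pred n) ∙ₛ (θ a ⊛ z (ℤ.pred (ℤ.pred n))))) j + X j ∎)
      where
      X = θ a ⊛ z (ℤ.pred n)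
      pred+1 : ∀ n → n ≡ ℤ.pred n ℤ.+ 1ℤ
      pred+1 n = ≡.trans (≡.sym (ℤP.suc-pred n)) (ℤP.+-comm 1ℤ (ℤ.pred n))

    θ-zpower : ∀ n → θ (z n) ≈ₛ fromℤ n ∙ₛ (θ a ⊛ z (ℤ.pred n))
    θ-zpower (+ zero)     = S.trans θ-one (λ j → sym (zeroˡ _))
    θ-zpower (+ suc n) j  = begin
      θ (a ⊛ z (+ n)) j                                        ≈⟨ θ-⊛ a (z (+ n)) j ⟩
      X j + (a ⊛ θ (z (+ n))) j                                ≈⟨ +-congˡ (⊛-congˡ a (θ-zpower (+ n)) j) ⟩
      X j + (a ⊛ (fromℤ (+ n) ∙ₛ (θ a ⊛ z (ℤ.pred (+ n))))) j  ≈⟨ +-congˡ (⊛-∙ₛ (fromℤ (+ n)) a (θ a ⊛ z (ℤ.pred (+ n))) j) ⟩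
      X j + fromℤ (+ n) * (a ⊛ (θ a ⊛ z (ℤ.pred (+ n)))) j     ≈⟨ +-cong (sym (*-identityˡ _)) (*-congˡ (⊛-swap (θ a) (+ n) j)) ⟩
      1# * X j + fromℤ (+ n) * X j                             ≈⟨ distribʳ _ _ _ ⟨
      fromℤ (+ suc n) * X j ∎
      where
      X = θ a ⊛ z (+ n)
    θ-zpower -[1+ zero ]  = θ-zpower-pred 0ℤ (θ-zpower 0ℤ)
    θ-zpower -[1+ suc n ] = θ-zpower-pred -[1+ n ] (θ-zpower -[1+ n ])

    residue : ∀ {b} → b ≈ₛ a +ₛ θ a → ∀ n j →
      fromℤ n * (b ⊛ z (ℤ.- n ℤ.- 1ℤ)) j ≈ fromℤ (n ℤ.- + j) * z (ℤ.- n) j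
    residue {b} b≈ n j = begin
      fromℤ n * (b ⊛ z (ℤ.- n ℤ.- 1ℤ)) j
        ≡⟨ ≡.cong (λ i → fromℤ n * (b ⊛ z i) j) (ℤP.+-comm (ℤ.- n) -1ℤ) ⟩
      fromℤ n * (b ⊛ z m′) j
        ≈⟨ *-congˡ (trans (⊛-congʳ (z m′) b≈ j)
             (trans (⊛-distribʳ (z m′) a (θ a) j) (+-congʳ (zpower-pred m j)))) ⟩
      fromℤ n * (Z + X)
        ≈⟨ +-cancelʳ (begin
             fromℤ n * (Z + X) + fromℤ (+ j) * Z      ≈⟨ +-congˡ (θ-zpower m j) ⟩
             fromℤ n * (Z + X) + fromℤ (ℤ.- n) * X
               ≈⟨ solve 4 (λ p q z x → p :* (z :+ x) :+ q :* x := p :* z :+ (p :+ q) :* x) refl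
                    (fromℤ n) (fromℤ (ℤ.- n)) Z X ⟩
             fromℤ n * Z + (fromℤ n + fromℤ (ℤ.- n)) * X
               ≈⟨ +-congˡ (trans (*-congʳ (trans (+-congˡ (fromℤ-neg n)) (-‿inverseʳ _))) (zeroˡ _)) ⟩
             fromℤ n * Z + 0#                         ≈⟨ +-identityʳ _ ⟩
             fromℤ n * Z                              ≡⟨ ≡.cong (λ i → fromℤ i * Z) (split n (+ j)) ⟩
             fromℤ (n ℤ.- + j ℤ.+ + j) * Z            ≈⟨ *-congʳ (fromℤ-+ (n ℤ.- + j) (+ j)) ⟩
             (fromℤ (n ℤ.- + j) + fromℤ (+ j)) * Z    ≈⟨ distribʳ _ _ _ ⟩
             fromℤ (n ℤ.- + j) * Z + fromℤ (+ j) * Z  ∎) ⟩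
      fromℤ (n ℤ.- + j) * Z ∎
      where
      m  = ℤ.- n
      m′ = ℤ.pred m
      Z  = z m j
      X  = (θ a ⊛ z m′) j
      split : ∀ n j → n ≡ n ℤ.- j ℤ.+ j
      split = solve-∀

  -- Roman factorials and Stirling numbers.

  ⌊_⌉#0 : ∀ n → ⌊ n ⌉ # 0#
  ⌊ + zero  ⌉#0 = 1#0
  ⌊ + suc n ⌉#0 = char0 (suc n)
  ⌊ -[1+ n ] ⌉#0 = neg#0 (char0 (suc n))

  -1^≢0 : ∀ m → -1ℤ ℤ.^ m ≢ 0ℤ
  -1^≢0 zero    ()
  -1^≢0 (suc m) e with ℤP.i*j≡0⇒i≡0∨j≡0 -1ℤ e
  ... | inj₂ e′ = -1^≢0 m e′

  ⌊_⌉!#0 : ∀ n → ⌊ n ⌉! # 0#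
  ⌊ + n ⌉!#0      = char0 (n !) {{n ℕP.!≢0}}
  ⌊ -[1+ m ] ⌉!#0 = x#0y#0→xy#0 (fromℤ#0 (-1ℤ ℤ.^ m) (-1^≢0 m)) (recip#0 (char0 (m !) {{m ℕP.!≢0}}))

  -- The conventions ⌊0⌉ = 1 and ⌊-1⌉! = 1 let the recursion pass through 0.
  factorial-pred : ∀ n → ⌊ n ⌉! ≈ ⌊ n ⌉ * ⌊ ℤ.pred n ⌉!
  factorial-pred (+ zero)  = begin
    fromℤ 1ℤ                          ≈⟨ fromℤ-1 ⟩
    1#                                ≈⟨ recip-inverseʳ (char0 1) ⟨
    fromℤ 1ℤ * recip (char0 1)        ≈⟨ *-identityˡ _ ⟨
    1# * (fromℤ 1ℤ * recip (char0 1)) ∎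
  factorial-pred (+ suc n) = ×1-homo-* (suc n) (n !)
  factorial-pred -[1+ m ]  = begin
    fromℤ s * R                                       ≈⟨ *-congˡ R≈ ⟩
    fromℤ s * (fromℤ (+ suc m) * R′)                  ≈⟨ *-assoc _ _ _ ⟨
    fromℤ s * fromℤ (+ suc m) * R′                    ≈⟨ *-congʳ (fromℤ-* s (+ suc m)) ⟨
    fromℤ (s ℤ.* + suc m) * R′                        ≡⟨ ≡.cong (λ i → fromℤ i * R′) (signs s (+ suc m)) ⟩
    fromℤ (-[1+ m ] ℤ.* (-1ℤ ℤ.* s)) * R′             ≈⟨ *-congʳ (fromℤ-* -[1+ m ] (-1ℤ ℤ.* s)) ⟩
    fromℤ -[1+ m ] * fromℤ (-1ℤ ℤ.* s) * R′           ≈⟨ *-assoc _ _ _ ⟩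
    fromℤ -[1+ m ] * (fromℤ (-1ℤ ℤ.* s) * R′)         ∎
    where
    s  = -1ℤ ℤ.^ m
    R  = recip (char0 (m !) {{m ℕP.!≢0}})
    R′ = recip (char0 (suc m !) {{suc m ℕP.!≢0}})
    signs : ∀ s n → s ℤ.* n ≡ (ℤ.- n) ℤ.* (-1ℤ ℤ.* s)
    signs = solve-∀
    R≈ : R ≈ fromℤ (+ suc m) * R′
    R≈ = *-cancelˡ (char0 (m !) {{m ℕP.!≢0}}) (begin
      fromℤ (+ (m !)) * R                          ≈⟨ recip-inverseʳ (char0 (m !) {{m ℕP.!≢0}}) ⟩
      1#                                           ≈⟨ recip-inverseʳ (char0 (suc m !) {{suc m ℕP.!≢0}}) ⟨
      fromℤ (+ (suc m !)) * R′                     ≈⟨ *-congʳ (×1-homo-* (suc m) (m !)) ⟩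
      fromℤ (+ suc m) * fromℤ (+ (m !)) * R′       ≈⟨ solve 3 (λ x y z → x :* y :* z := y :* (x :* z)) refl _ _ _ ⟩
      fromℤ (+ (m !)) * (fromℤ (+ suc m) * R′)     ∎)

  -- This is Γ(y-m+1) = (y-m) Γ(y-m). For negative m the new factor cancels the last one of
  -- `recipRising`.
  gammaQuotient-suc : ∀ m → gammaQuotient (ℤ.suc m) ≈ₛ gammaQuotient m ⊛ (y+ fromℤ (ℤ.- m))
  gammaQuotient-suc (+ m)         = S.refl
  gammaQuotient-suc -[1+ m ] =
    S.trans (S.reflexive (suc-neg m)) (S.sym (S.trans (⊛-assoc (recipRising m) (inverse y y₀#0) y)
      (S.trans (⊛-congˡ (recipRising m) (S.trans (⊛-comm (inverse y y₀#0) y) (⊛-inverseʳ y y₀#0)))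
               (S.*-identityʳ (recipRising m)))))
    where
    y = y+ fromℤ (+ suc m)
    y₀#0 = char0 (suc m)
    suc-neg : ∀ m → gammaQuotient (ℤ.suc -[1+ m ]) ≡ recipRising m
    suc-neg zero    = ≡.refl
    suc-neg (suc m) = ≡.refl

  gammaQuotient-neg : ∀ n → gammaQuotient (ℤ.- n) ≈ₛ
                            gammaQuotient (ℤ.- ℤ.suc n) ⊛ (y+ fromℤ (ℤ.suc n))
  gammaQuotient-neg n = S.trans (S.reflexive (≡.cong gammaQuotient (suc-neg n)))
    (S.trans (gammaQuotient-suc (ℤ.- ℤ.suc n))
      (S.reflexive (≡.cong (λ i → gammaQuotient (ℤ.- ℤ.suc n) ⊛ (y+ fromℤ i))
        (ℤP.neg-involutive (ℤ.suc n)))))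
    where
    suc-neg : ∀ n → ℤ.- n ≡ 1ℤ ℤ.+ ℤ.- (1ℤ ℤ.+ n)
    suc-neg = solve-∀

  ⊛-y+ : ∀ a x r → (a ⊛ (y+ x)) (suc r) ≈ a r + x * a (suc r)
  ⊛-y+ a x r = begin
    (a ⊛ (y+ x)) (suc r)                    ≈⟨ ⊛-comm a (y+ x) (suc r) ⟩
    x * a (suc r) + (tail (y+ x) ⊛ a) r     ≈⟨ +-comm _ _ ⟩
    (tail (y+ x) ⊛ a) r + x * a (suc r)     ≈⟨ +-congʳ (trans (⊛-congʳ a tail≈one r) (⊛-identityˡ a r)) ⟩
    a r + x * a (suc r)                     ∎
    where
    tail≈one : tail (y+ x) ≈ₛ one
    tail≈one zero    = refl
    tail≈one (suc n) = refl

  -- The factor ⌊n⌉! s(-n,r) of the coefficients of λ_n with ρ_1 = r.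
  ξ : ℤ → ℕ → Carrier
  ξ n r = ⌊ n ⌉! * stirling (ℤ.- n) r

  factorial-suc : ∀ n → ⌊ ℤ.suc n ⌉! ≈ ⌊ ℤ.suc n ⌉ * ⌊ n ⌉!
  factorial-suc n = trans (factorial-pred (ℤ.suc n))
    (*-congˡ (reflexive (≡.cong ⌊_⌉! (ℤP.pred-suc n))))

  ξ-step-zero : ∀ n → ⌊ ℤ.suc n ⌉ * ξ n 0 ≈ fromℤ (ℤ.suc n) * ξ (ℤ.suc n) 0
  ξ-step-zero n = begin
    ⌊ ℤ.suc n ⌉ * (⌊ n ⌉! * stirling (ℤ.- n) 0)
      ≈⟨ *-assoc _ _ _ ⟨
    ⌊ ℤ.suc n ⌉ * ⌊ n ⌉! * stirling (ℤ.- n) 0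
      ≈⟨ *-cong (sym (factorial-suc n)) (gammaQuotient-neg n 0) ⟩
    ⌊ ℤ.suc n ⌉! * (stirling (ℤ.- ℤ.suc n) 0 * fromℤ (ℤ.suc n) + 0#)
      ≈⟨ solve 3 (λ x y z → x :* (y :* z :+ con 0) := z :* (x :* y)) refl _ _ _ ⟩
    fromℤ (ℤ.suc n) * ξ (ℤ.suc n) 0 ∎

  -- The recurrence s(-n,r+1) = s(-n-1,r) + (n+1) s(-n-1,r+1), multiplied by ⌊n+1⌉!. The right side
  -- lists the two sources of a coefficient of D λ_{n+1}: differentiating a logarithm and
  -- differentiating the power of x.
  ξ-step-suc : ∀ n r → ⌊ ℤ.suc n ⌉ * ξ n (suc r) ≈
                       ξ (ℤ.suc n) r + fromℤ (ℤ.suc n) * ξ (ℤ.suc n) (suc r)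
  ξ-step-suc n r = begin
    ⌊ ℤ.suc n ⌉ * (⌊ n ⌉! * stirling (ℤ.- n) (suc r))
      ≈⟨ *-assoc _ _ _ ⟨
    ⌊ ℤ.suc n ⌉ * ⌊ n ⌉! * stirling (ℤ.- n) (suc r)
      ≈⟨ *-cong (sym (factorial-suc n))
                (trans (gammaQuotient-neg n (suc r)) (⊛-y+ (stirling (ℤ.- ℤ.suc n)) (fromℤ (ℤ.suc n)) r)) ⟩
    ⌊ ℤ.suc n ⌉! * (stirling (ℤ.- ℤ.suc n) r + fromℤ (ℤ.suc n) * stirling (ℤ.- ℤ.suc n) (suc r))
      ≈⟨ solve 4 (λ x y z w → x :* (y :+ z :* w) := x :* y :+ z :* (x :* w)) refl _ _ _ _ ⟩
    ξ (ℤ.suc n) r + fromℤ (ℤ.suc n) * ξ (ℤ.suc n) (suc r) ∎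

  ξ-nonneg-0 : ∀ n → ξ (+ n) 0 ≈ 1#
  ξ-nonneg-0 zero    = trans (*-identityʳ _) fromℤ-1
  ξ-nonneg-0 (suc n) = trans (sym (*-cancelˡ (char0 (suc n)) (ξ-step-zero (+ n)))) (ξ-nonneg-0 n)

  -- At n = -1 the step has ⌊0⌉ = 1 on the left but the integer 0 on the right, which forces ξ to
  -- vanish at -1; below that the common nonzero factor cancels.
  ξ-neg-0 : ∀ k → ξ -[1+ k ] 0 ≈ 0#
  ξ-neg-0 zero    = trans (sym (*-identityˡ _)) (trans (ξ-step-zero -1ℤ) (zeroˡ _))
  ξ-neg-0 (suc k) = trans (*-cancelˡ (neg#0 (char0 (suc k))) (ξ-step-zero -[1+ suc k ])) (ξ-neg-0 k)

  ξ-neg-1 : ∀ k → ξ -[1+ k ] 1 ≈ 1#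
  ξ-neg-1 zero    = begin
    ξ -1ℤ 1                 ≈⟨ *-identityˡ _ ⟨
    1# * ξ -1ℤ 1            ≈⟨ ξ-step-suc -1ℤ 0 ⟩
    ξ 0ℤ 0 + 0# * ξ 0ℤ 1    ≈⟨ +-cong (ξ-nonneg-0 0) (zeroˡ _) ⟩
    1# + 0#                 ≈⟨ +-identityʳ 1# ⟩
    1#                      ∎
  ξ-neg-1 (suc k) = trans (*-cancelˡ (neg#0 (char0 (suc k)))
    (trans (ξ-step-suc -[1+ suc k ] 0) (trans (+-congʳ (ξ-neg-0 k)) (+-identityˡ _)))) (ξ-neg-1 k)

  -- The derivative of a series of harmonic logarithms.

  -- Separates the dependence on n, governed by the recurrence of ξ, from that on the shape of ρ,
  -- governed by `pieri`.
  harmonic-coeff : ∀ n α β → coeff (harmonicLog n α) n β ≈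
                             ξ n ∣ entry (α -ᵥ β) 0 ∣ * fromℤ (weight α (α -ᵥ β))
  harmonic-coeff n α β = trans
    (reflexive (≡.cong (if_then harmonicCoeff n α (α -ᵥ β) else 0#) (dec-true (n ℤP.≟ n) ≡.refl)))
    (if-* (does (isPartition? (α -ᵥ β))))
    where
    if-* : ∀ b {x w} → (if b then x * fromℤ w else 0#) ≈ x * fromℤ (if b then w else 0ℤ)
    if-* true  = refl
    if-* false = sym (zeroʳ _)

  fromℤ-sum : ∀ n (f : ℕ → ℤ) →
    fromℤ (∑ℤ n f) ≈ ∑[ i < n ] fromℤ (f (toℕ i))
  fromℤ-sum zero    f = refl
  fromℤ-sum (suc n) f = trans (fromℤ-+ (f 0) _) (+-congˡ (fromℤ-sum n (f ∘ suc)))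

  module _ (α : Vector) (S : Expansion) (m : ℤ) (β : Vector) where
    private
      n = ℤ.suc m
      ρ = α -ᵥ β
      κ = coef S n
      removed : ℕ → Vector
      removed i = ρ -ᵥ ones (suc i)
      removed-≐ : ∀ i → α -ᵥ (β +ᵥ ones (suc i)) ≐ removed i
      removed-≐ i j = reassoc (entry α j) (entry β j) (entry (ones (suc i)) j)
        where
        reassoc : ∀ x y z → x ℤ.- (y ℤ.+ z) ≡ x ℤ.- y ℤ.- z
        reassoc = solve-∀

    derivativeTerm-expand : ∀ i → derivativeTerm (expand α S) m β i ≈
      κ * ξ n ∣ entry (removed i) 0 ∣
        * fromℤ (pieriTerm α ρ i)
    derivativeTerm-expand i = begin
      fromℤ (entry β i ℤ.+ 1ℤ) * (κ * coeff (harmonicLog n α) n (β +ᵥ ones (suc i)))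
        ≈⟨ *-cong (reflexive (≡.cong (λ x → fromℤ (x ℤ.+ 1ℤ)) (cancel (entry α i) (entry β i))))
                  (*-congˡ (trans (harmonic-coeff n α (β +ᵥ ones (suc i)))
                    (reflexive (≡.cong₂ (λ x w → ξ n ∣ x ∣ * fromℤ w) (removed-≐ i 0)
                      (weight-cong α {α -ᵥ (β +ᵥ ones (suc i))} {removed i} (removed-≐ i)))))) ⟩
      fromℤ b * (κ * (X * fromℤ w))    ≈⟨ solve 4 (λ b k x w → b :* (k :* (x :* w)) := k :* x :* (b :* w)) refl _ _ _ _ ⟩
      κ * X * (fromℤ b * fromℤ w)      ≈⟨ *-congˡ (fromℤ-* b w) ⟨
      κ * X * fromℤ (b ℤ.* w)          ∎
      where
      b = entry α i ℤ.- entry ρ i ℤ.+ 1ℤ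
      w = weight α (removed i)
      X = ξ n ∣ entry (removed i) 0 ∣
      cancel : ∀ x y → y ≡ x ℤ.- (x ℤ.- y)
      cancel = solve-∀

    derivative-zero : ¬ 0ℤ ℤ.< entry ρ 0 →
      ∑[ i < bound ρ ] derivativeTerm (expand α S) m β (toℕ i) ≈ 0#
    derivative-zero ρ₀≯0 = sum-zero +-monoid (bound ρ) (derivativeTerm (expand α S) m β) (λ i _ →
      trans (derivativeTerm-expand i)
      (trans (*-congˡ (reflexive (≡.cong fromℤ (≡.trans
               (≡.cong ((entry α i ℤ.- entry ρ i ℤ.+ 1ℤ) ℤ.*_) (weight-remove-zero α ρ i ρ₀≯0))
               (ℤP.*-zeroʳ (entry α i ℤ.- entry ρ i ℤ.+ 1ℤ))))))
             (zeroʳ _)))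

    -- Every column meets the first row, so all the removed shapes have first part r; ξ n r leaves
    -- the sum and the Pieri rule evaluates the rest.
    derivative-pieri : ∀ r → entry ρ 0 ≡ + suc r →
      ∑[ i < bound ρ ] derivativeTerm (expand α S) m β (toℕ i) ≈ κ * ξ n r * fromℤ (weight α ρ)
    derivative-pieri r ρ₀ = begin
      ∑[ i < bound ρ ] derivativeTerm (expand α S) m β (toℕ i)
        ≈⟨ sum-cong +-monoid (bound ρ) (λ i → trans (derivativeTerm-expand i)
             (*-congʳ (*-congˡ (reflexive (≡.cong (λ x → ξ n ∣ x ℤ.- 1ℤ ∣) ρ₀))))) ⟩
      ∑[ i < bound ρ ] (κ * ξ n r * fromℤ (pieriTerm α ρ (toℕ i)))
        ≈⟨ *-distribˡ-sum {bound ρ} (κ * ξ n r) (λ i → fromℤ (pieriTerm α ρ (toℕ i))) ⟨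
      κ * ξ n r * (∑[ i < bound ρ ] fromℤ (pieriTerm α ρ (toℕ i)))
        ≈⟨ *-congˡ (fromℤ-sum (bound ρ) (pieriTerm α ρ)) ⟨
      κ * ξ n r * fromℤ (∑ℤ (bound ρ) (pieriTerm α ρ))
        ≡⟨ ≡.cong (λ x → κ * ξ n r * fromℤ x)
             (pieri α ρ (≡.subst (0ℤ ℤ.<_) (≡.sym ρ₀) (ℤ.+<+ (s≤s z≤n)))) ⟩
      κ * ξ n r * fromℤ (weight α ρ) ∎

    -- The sign of the first part of ρ decides: if it is positive, both sources contribute; if it is
    -- 0, only the power of x does; if it is negative, both sides vanish. The summation range of `D`
    -- is `bound ρ` by computation.
    D-expand-coeff : coeff (D (expand α S)) m β ≈ ⌊ n ⌉ * κ * coeff (harmonicLog m α) m β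
    D-expand-coeff with ℤP.<-cmp 0ℤ (entry ρ 0)
    ... | tri< 0<ρ₀ _ _ = begin
      _ ≈⟨ +-cong (*-congˡ (*-congˡ (trans (harmonic-coeff n α β) (*-congʳ (reflexive ξ≡)))))
                  (derivative-pieri r ρ₀≡) ⟩
      fromℤ n * (κ * (ξ n (suc r) * W)) + κ * ξ n r * W
        ≈⟨ solve 5 (λ f k x w x′ → f :* (k :* (x :* w)) :+ k :* x′ :* w := (x′ :+ f :* x) :* (k :* w)) refl _ _ _ _ _ ⟩
      (ξ n r + fromℤ n * ξ n (suc r)) * (κ * W)   ≈⟨ *-congʳ (ξ-step-suc m r) ⟨
      ⌊ n ⌉ * ξ m (suc r) * (κ * W)               ≈⟨ solve 4 (λ f x k w → f :* x :* (k :* w) := f :* k :* (x :* w)) refl _ _ _ _ ⟩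
      ⌊ n ⌉ * κ * (ξ m (suc r) * W)               ≈⟨ *-congˡ (trans (harmonic-coeff m α β) (*-congʳ (reflexive (≡.cong (λ x → ξ m ∣ x ∣) ρ₀≡)))) ⟨
      _ ∎
      where
      W = fromℤ (weight α ρ)
      r = ∣ entry ρ 0 ∣ ℕ.∸ 1
      positive : ∀ {x} → 0ℤ ℤ.< x → x ≡ + suc (∣ x ∣ ℕ.∸ 1)
      positive (ℤ.+<+ (s≤s _)) = ≡.refl
      ρ₀≡ : entry ρ 0 ≡ + suc r
      ρ₀≡ = positive 0<ρ₀
      ξ≡ : ξ n ∣ entry ρ 0 ∣ ≡ ξ n (suc r)
      ξ≡ = ≡.cong (λ x → ξ n ∣ x ∣) ρ₀≡
    ... | tri≈ ρ₀≯0 0≡ρ₀ _ = begin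
      _ ≈⟨ +-cong (*-congˡ (*-congˡ (trans (harmonic-coeff n α β) (*-congʳ (reflexive (≡.cong (λ x → ξ n ∣ x ∣) (≡.sym 0≡ρ₀)))))))
                  (derivative-zero ρ₀≯0) ⟩
      fromℤ n * (κ * (ξ n 0 * W)) + 0#     ≈⟨ solve 4 (λ f k x w → f :* (k :* (x :* w)) :+ con 0 := f :* x :* (k :* w)) refl _ _ _ _ ⟩
      fromℤ n * ξ n 0 * (κ * W)            ≈⟨ *-congʳ (ξ-step-zero m) ⟨
      ⌊ n ⌉ * ξ m 0 * (κ * W)              ≈⟨ solve 4 (λ f x k w → f :* x :* (k :* w) := f :* k :* (x :* w)) refl _ _ _ _ ⟩
      ⌊ n ⌉ * κ * (ξ m 0 * W)              ≈⟨ *-congˡ (trans (harmonic-coeff m α β) (*-congʳ (reflexive (≡.cong (λ x → ξ m ∣ x ∣) (≡.sym 0≡ρ₀))))) ⟨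
      _ ∎
      where W = fromℤ (weight α ρ)
    ... | tri> ρ₀≯0 _ ρ₀<0 = begin
      _ ≈⟨ +-cong (trans (*-congˡ (trans (*-congˡ (vanish n)) (zeroʳ _))) (zeroʳ _)) (derivative-zero ρ₀≯0) ⟩
      0# + 0#   ≈⟨ +-identityʳ 0# ⟩
      0#        ≈⟨ trans (*-congˡ (vanish m)) (zeroʳ _) ⟨
      _ ∎
      where
      vanish : ∀ k → coeff (harmonicLog k α) k β ≈ 0#
      vanish k = trans (harmonic-coeff k α β)
        (trans (*-congˡ (reflexive (≡.cong fromℤ (weight-negative α {ρ} ρ₀<0)))) (zeroʳ _))

  -- Operators respect equality of series.

  ≋-sym : ∀ {F G} → F ≋ G → G ≋ F
  ≋-sym e n β = sym (e n β)

  ≋-trans : ∀ {F G H} → F ≋ G → G ≋ H → F ≋ H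
  ≋-trans e e′ n β = trans (e n β) (e′ n β)

  -- `≋` compares coefficients only, so the two widths, and with them the summation ranges, may
  -- differ; beyond its width each series contributes zeros.
  D-cong : ∀ {F G} → F ≋ G → D F ≋ D G
  D-cong {F} {G} F≋G n β = +-cong (*-congˡ (F≋G (ℤ.suc n) β))
    (sum-range +-monoid (width F ℕ.⊔ bound β) (width G ℕ.⊔ bound β)
      (λ i → *-congˡ (F≋G (ℤ.suc n) (β +ᵥ ones (suc i))))
      (derivativeTerm-zero F n β) (derivativeTerm-zero G n β))

  D^-cong : ∀ k {F G} → F ≋ G → D^ k F ≋ D^ k G
  D^-cong zero    F≋G = F≋G
  D^-cong (suc k) {F} {G} F≋G = D-cong {D^ k F} {D^ k G} (D^-cong k {F} {G} F≋G)

  degree-D^ : ∀ k F → degree (D^ k F) ≡ degree F ℤ.- + k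
  degree-D^ zero    F = ≡.sym (ℤP.+-identityʳ (degree F))
  degree-D^ (suc k) F = ≡.trans (≡.cong ℤ.pred (degree-D^ k F)) (shift (degree F) (+ k))
    where
    shift : ∀ d k → -1ℤ ℤ.+ (d ℤ.- k) ≡ d ℤ.- (1ℤ ℤ.+ k)
    shift = solve-∀

  i≤∣i∣ : ∀ i → i ℤ.≤ + ∣ i ∣
  i≤∣i∣ (+ n)    = ℤP.≤-refl
  i≤∣i∣ -[1+ n ] = ℤ.-≤+

  D^-vanishes : ∀ F n β k → suc ∣ degree F ℤ.- n ∣ ℕ.≤ k → coeff (D^ k F) n β ≈ 0#
  D^-vanishes F n β k d<k = degree-bound (D^ k F) n β
    (≡.subst (ℤ._< n) (≡.sym (degree-D^ k F))
      (≡.subst₂ ℤ._<_ (left (degree F) n (+ k)) (right n (+ k))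
        (ℤP.+-monoˡ-< (n ℤ.- + k) (ℤP.≤-<-trans (i≤∣i∣ (degree F ℤ.- n)) (ℤ.+<+ d<k)))))
    where
    left : ∀ d n k → d ℤ.- n ℤ.+ (n ℤ.- k) ≡ d ℤ.- k
    left = solve-∀
    right : ∀ n k → k ℤ.+ (n ℤ.- k) ≡ n
    right = solve-∀

  ⟨D⟩-cong : ∀ {a b F G} → a ≈ₛ b → F ≋ G → a ⟨D⟩ F ≋ b ⟨D⟩ G
  ⟨D⟩-cong {a} {b} {F} {G} a≈b F≋G n β =
    sum-range +-monoid (suc ∣ degree F ℤ.- n ∣) (suc ∣ degree G ℤ.- n ∣)
      (λ k → *-cong (a≈b k) (D^-cong k {F} {G} F≋G n β))
      (λ k r≤k → trans (*-congˡ (D^-vanishes F n β k r≤k)) (zeroʳ _))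
      (λ k r≤k → trans (*-congˡ (D^-vanishes G n β k r≤k)) (zeroʳ _))

  expand-cong : ∀ {α S T} → (∀ m → coef S m ≈ coef T m) → expand α S ≋ expand α T
  expand-cong e n β = *-congʳ (e n)

  derivativeExpansion : Expansion → Expansion
  derivativeExpansion S = record
    { coef       = λ m → ⌊ ℤ.suc m ⌉ * coef S (ℤ.suc m)
    ; top        = ℤ.pred (top S)
    ; coef-bound = λ m t<m → trans
        (*-congˡ (coef-bound S (ℤ.suc m)
          (≡.subst (ℤ._< ℤ.suc m) (ℤP.suc-pred (top S)) (ℤP.+-monoʳ-< 1ℤ t<m))))
        (zeroʳ _)
    }

  derivativeExpansion^ : ℕ → Expansion → Expansion
  derivativeExpansion^ zero    S = S
  derivativeExpansion^ (suc k) S = derivativeExpansion (derivativeExpansion^ k S)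

  D^-expand : ∀ k α S → D^ k (expand α S) ≋ expand α (derivativeExpansion^ k S)
  D^-expand zero    α S m β = refl
  D^-expand (suc k) α S m β = trans
    (D-cong {D^ k (expand α S)} {expand α (derivativeExpansion^ k S)} (D^-expand k α S) m β)
    (D-expand-coeff α (derivativeExpansion^ k S) m β)

  -- Series of harmonic logarithms as Laurent series in D.

  recip! : ℤ → Carrier
  recip! n = recip ⌊ n ⌉!#0

  recip!-pred : ∀ n → recip! (ℤ.pred n) ≈ ⌊ n ⌉ * recip! n
  recip!-pred n = *-cancelˡ ⌊ ℤ.pred n ⌉!#0 (begin
    ⌊ ℤ.pred n ⌉! * recip! (ℤ.pred n)     ≈⟨ recip-inverseʳ ⌊ ℤ.pred n ⌉!#0 ⟩
    1#                                    ≈⟨ recip-inverseʳ ⌊ n ⌉!#0 ⟨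
    ⌊ n ⌉! * recip! n                     ≈⟨ *-congʳ (factorial-pred n) ⟩
    ⌊ n ⌉ * ⌊ ℤ.pred n ⌉! * recip! n      ≈⟨ solve 3 (λ x y z → x :* y :* z := y :* (x :* z)) refl _ _ _ ⟩
    ⌊ ℤ.pred n ⌉! * (⌊ n ⌉ * recip! n)    ∎)

  recip!-suc : ∀ n → recip! n ≈ ⌊ ℤ.suc n ⌉ * recip! (ℤ.suc n)
  recip!-suc n = trans (reflexive (≡.cong recip! (≡.sym (ℤP.pred-suc n)))) (recip!-pred (ℤ.suc n))

  at : PowerSeries → ℤ → Carrier
  at h (+ j)    = h j
  at h -[1+ j ] = 0#

  at-cong : ∀ {h h′} → h ≈ₛ h′ → ∀ i → at h i ≈ at h′ i
  at-cong e (+ j)    = e j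
  at-cong e -[1+ j ] = refl

  at-negative : ∀ h {i} → i ℤ.< 0ℤ → at h i ≡ 0#
  at-negative h {+ j}      (ℤ.+<+ ())
  at-negative h { -[1+ j ]} _ = ≡.refl

  -- As D (λ_m / ⌊m⌉!) = λ_{m-1} / ⌊m-1⌉!, identifying λ_m / ⌊m⌉! with D^{-m}
  -- makes 𝓛^α a space of Laurent series in D; this is h(D) D^{-N}.
  laurent : ℤ → PowerSeries → Expansion
  laurent N h = record
    { coef       = λ m → at h (N ℤ.- m) * recip! m
    ; top        = N
    ; coef-bound = λ m N<m → trans (*-congʳ (reflexive (at-negative h (negative N<m)))) (zeroˡ _)
    }
    where
    negative : ∀ {m} → N ℤ.< m → N ℤ.- m ℤ.< 0ℤ
    negative {m} N<m = ≡.subst (N ℤ.- m ℤ.<_) (ℤP.+-inverseʳ m) (ℤP.+-monoˡ-< (ℤ.- m) N<m)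

  laurent-cong : ∀ {α N h h′} → h ≈ₛ h′ → expand α (laurent N h) ≋ expand α (laurent N h′)
  laurent-cong {N = N} e m β = *-congʳ (*-congʳ (at-cong e (N ℤ.- m)))

  derivativeExpansion^-laurent : ∀ k N h m →
    coef (derivativeExpansion^ k (laurent N h)) m ≈ at h (N ℤ.- m ℤ.- + k) * recip! m
  derivativeExpansion^-laurent zero    N h m =
    *-congʳ (reflexive (≡.cong (at h) (≡.sym (ℤP.+-identityʳ (N ℤ.- m)))))
  derivativeExpansion^-laurent (suc k) N h m = begin
    ⌊ ℤ.suc m ⌉ * coef (derivativeExpansion^ k (laurent N h)) (ℤ.suc m)
      ≈⟨ *-congˡ (derivativeExpansion^-laurent k N h (ℤ.suc m)) ⟩
    ⌊ ℤ.suc m ⌉ * (at h (N ℤ.- ℤ.suc m ℤ.- + k) * recip! (ℤ.suc m))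
      ≈⟨ solve 3 (λ x y z → x :* (y :* z) := y :* (x :* z)) refl _ _ _ ⟩
    at h (N ℤ.- ℤ.suc m ℤ.- + k) * (⌊ ℤ.suc m ⌉ * recip! (ℤ.suc m))
      ≈⟨ *-cong (reflexive (≡.cong (at h) (shift N m (+ k)))) (sym (recip!-suc m)) ⟩
    at h (N ℤ.- m ℤ.- + suc k) * recip! m ∎
    where
    shift : ∀ n m k → n ℤ.- (1ℤ ℤ.+ m) ℤ.- k ≡ n ℤ.- m ℤ.- (1ℤ ℤ.+ k)
    shift = solve-∀

  ⊛-at : ∀ a h i → ∑[ k < suc ∣ i ∣ ] (a (toℕ k) * at h (i ℤ.- + toℕ k)) ≈ at (a ⊛ h) i
  ⊛-at a h (+ j) = sum-cong-≋ {suc j} λ k → *-congˡ {a (toℕ k)} (reflexive (≡.cong (at h) (≡.trans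
    (ℤP.m-n≡m⊖n j (toℕ k)) (ℤP.≤-⊖ (ℕP.≤-pred (FinP.toℕ<n k))))))
  ⊛-at a h i@(-[1+ j ]) = sum-zero +-monoid (suc (suc j)) (λ k → a k * at h (i ℤ.- + k))
    (λ k _ → trans (*-congˡ (reflexive (at-negative h (ℤP.≤-<-trans (ℤP.i-j≤i i (+ k)) ℤ.-<+)))) (zeroʳ _))

  -- D^k moves the coefficients of h up by k degrees, so Σ a_k D^k acts as the Cauchy product with
  -- a; for m ≤ N the cutoff at ∣N - m∣ is the range of that product.
  ⟨D⟩-laurent : ∀ a N h α →
    a ⟨D⟩ expand α (laurent N h) ≋ expand α (laurent N (a ⊛ h))
  ⟨D⟩-laurent a N h α m β = begin
    ∑[ k < range ] (a (toℕ k) * coeff (D^ (toℕ k) (expand α (laurent N h))) m β)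
      ≈⟨ sum-cong +-monoid range (λ k → *-congˡ {a k} (trans (D^-expand k α (laurent N h) m β)
           (*-congʳ (derivativeExpansion^-laurent k N h m)))) ⟩
    ∑[ k < range ] (a (toℕ k) * (at h (N ℤ.- m ℤ.- + toℕ k) * recip! m * H))
      ≈⟨ sum-cong +-monoid range (λ k →
           solve 4 (λ x y z w → x :* (y :* z :* w) := x :* y :* (z :* w)) refl
             (a k) (at h (N ℤ.- m ℤ.- + k)) (recip! m) H) ⟩
    ∑[ k < range ] (a (toℕ k) * at h (N ℤ.- m ℤ.- + toℕ k) * (recip! m * H))
      ≈⟨ *-distribʳ-sum {range} (recip! m * H) (λ k → a (toℕ k) * at h (N ℤ.- m ℤ.- + toℕ k)) ⟨
    (∑[ k < range ] (a (toℕ k) * at h (N ℤ.- m ℤ.- + toℕ k))) * (recip! m * H)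
      ≈⟨ *-congʳ (⊛-at a h (N ℤ.- m)) ⟩
    at (a ⊛ h) (N ℤ.- m) * (recip! m * H)
      ≈⟨ *-assoc _ _ _ ⟨
    at (a ⊛ h) (N ℤ.- m) * recip! m * H ∎
    where
    range = suc ∣ N ℤ.- m ∣
    H = coeff (harmonicLog m α) m β

  harmonicLog-laurent : ∀ n α → harmonicLog n α ≋ expand α (laurent n (⌊ n ⌉! ∙ₛ one))
  harmonicLog-laurent n α m β with m ℤP.≟ n
  ... | yes ≡.refl = begin
    harmonicCoeff n α (α -ᵥ β)
      ≡⟨ ≡.cong (if_then harmonicCoeff n α (α -ᵥ β) else 0#) (dec-true (n ℤP.≟ n) ≡.refl) ⟨
    H                                                   ≈⟨ *-identityˡ H ⟨
    1# * H                                              ≈⟨ *-congʳ (recip-inverseʳ ⌊ n ⌉!#0) ⟨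
    ⌊ n ⌉! * recip! n * H                               ≈⟨ *-congʳ (*-congʳ (*-identityʳ _)) ⟨
    ⌊ n ⌉! * 1# * recip! n * H                          ≡⟨ ≡.cong (λ i → at (⌊ n ⌉! ∙ₛ one) i * recip! n * H) (ℤP.+-inverseʳ n) ⟨
    at (⌊ n ⌉! ∙ₛ one) (n ℤ.- n) * recip! n * H         ∎
    where H = coeff (harmonicLog n α) n β
  ... | no m≢n = sym (trans (*-congʳ (trans (*-congʳ (at-one (n ℤ.- m)
      (λ e → m≢n (≡.sym (ℤP.i-j≡0⇒i≡j n m e))))) (zeroˡ _))) (zeroˡ _))
    where
    at-one : ∀ i → i ≢ 0ℤ → at (⌊ n ⌉! ∙ₛ one) i ≈ 0#
    at-one (+ zero)  i≢0 = contradiction ≡.refl i≢0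
    at-one (+ suc j) i≢0 = zeroʳ _
    at-one -[1+ j ]  i≢0 = refl

  normal : Expansion → PowerSeries
  normal S j = coef S (top S ℤ.- + j) * ⌊ top S ℤ.- + j ⌉!

  expand-laurent : ∀ α S → expand α S ≋ expand α (laurent (top S) (normal S))
  expand-laurent α S = expand-cong {α} {S} {laurent (top S) (normal S)} λ m →
    coefficient m (top S ℤ.- m) (≡.sym (difference (top S) m))
    where
    difference : ∀ t m → t ℤ.- (t ℤ.- m) ≡ m
    difference = solve-∀
    coefficient : ∀ m i → m ≡ top S ℤ.- i → coef S m ≈ at (normal S) i * recip! m
    coefficient m (+ j) ≡.refl = begin
      coef S m                                ≈⟨ *-identityʳ _ ⟨
      coef S m * 1#                           ≈⟨ *-congˡ (recip-inverseʳ ⌊ m ⌉!#0) ⟨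
      coef S m * (⌊ m ⌉! * recip! m)          ≈⟨ *-assoc _ _ _ ⟨
      coef S m * ⌊ m ⌉! * recip! m            ∎
    coefficient m -[1+ j ] ≡.refl = trans (coef-bound S m
      (≡.subst (ℤ._< m) (ℤP.+-identityʳ (top S)) (ℤP.+-monoʳ-< (top S) (ℤ.+<+ (s≤s z≤n)))))
      (sym (zeroˡ _))

  ⟨D⟩-harmonicLog : ∀ a n α → a ⟨D⟩ harmonicLog n α ≋ expand α (laurent n (⌊ n ⌉! ∙ₛ a))
  ⟨D⟩-harmonicLog a n α m β = trans
    (⟨D⟩-cong {a} {a} {harmonicLog n α} {expand α (laurent n (⌊ n ⌉! ∙ₛ one))}
      (λ _ → refl) (harmonicLog-laurent n α) m β)
    (trans (⟨D⟩-laurent a n (⌊ n ⌉! ∙ₛ one) α m β)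
      (laurent-cong {α} {n} (λ j → trans (⊛-∙ₛ ⌊ n ⌉! a one j) (*-congˡ (S.*-identityʳ a j))) m β))

  -- Uniqueness of the solution of g k_{n+1} = k_n.

  ⊛-cong-≤ : ∀ a {u v} j → (∀ i → i ℕ.≤ j → u i ≈ v i) → (a ⊛ u) j ≈ (a ⊛ v) j
  ⊛-cong-≤ a j u≈v = sum-cong-≋ {suc j} λ i → *-congˡ {a (toℕ i)} (u≈v (j ℕ.∸ toℕ i) (ℕP.m∸n≤m j (toℕ i)))

  -- In degree j the product is a_0 u_j plus terms in the u_i with i < j, and a_0 is invertible.
  ⊛-cancel-≤ : ∀ a {u v} j → a 0 # 0# → (∀ i → i ℕ.< j → u i ≈ v i) →
               (a ⊛ u) j ≈ (a ⊛ v) j → u j ≈ v j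
  ⊛-cancel-≤ a zero    a₀#0 u≈v e = *-cancelˡ a₀#0 (+-cancelʳ e)
  ⊛-cancel-≤ a (suc j) a₀#0 u≈v e = *-cancelˡ a₀#0 (+-cancelʳ
    (trans e (+-congˡ (sym (⊛-cong-≤ (tail a) j (λ i i≤j → u≈v i (s≤s i≤j)))))))

  -- A solution of g k_{n+1} = k_n is determined by the entries k_j(j): comparing
  -- degree j, once two solutions agree below j their j-th coefficients agree
  -- for k_n if and only if they do for k_{n+1}.
  module _ (g : PowerSeries) (g₀#0 : g 0 # 0#) (k k′ : ℤ → PowerSeries)
    (Active : ℤ → Set) (active-≤ : ∀ {i j} → i ℤ.≤ j → Active i → Active j)
    (active-+ : ∀ n → Active (+ n))
    (step  : ∀ n j → Active (n ℤ.- + j) → (g ⊛ k  (ℤ.suc n)) j ≈ k  n j)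
    (step′ : ∀ n j → Active (n ℤ.- + j) → (g ⊛ k′ (ℤ.suc n)) j ≈ k′ n j)
    (base : ∀ j → k (+ j) j ≈ k′ (+ j) j)
    where

    private
      Agree : ℕ → Set ℓ₁
      Agree j = ∀ n → Active (n ℤ.- + j) → k n j ≈ k′ n j

      module _ {j} (below : ∀ {i} → i ℕ.< j → Agree i) where
        lower : ∀ n → Active (n ℤ.- + j) → ∀ i → i ℕ.< j → k (ℤ.suc n) i ≈ k′ (ℤ.suc n) i
        lower n act i i<j = below i<j (ℤ.suc n)
          -- Here (n + 1) - i ≥ n - j, so activity passes to the lower degree.
          (active-≤ (ℤP.+-mono-≤ (ℤP.i≤suc[i] n) (ℤP.neg-mono-≤ (ℤ.+≤+ (ℕP.<⇒≤ i<j)))) act)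

        forward : ∀ n → Active (n ℤ.- + j) → k n j ≈ k′ n j → k (ℤ.suc n) j ≈ k′ (ℤ.suc n) j
        forward n act e = ⊛-cancel-≤ g j g₀#0 (lower n act)
          (trans (step n j act) (trans e (sym (step′ n j act))))

        backward : ∀ n → Active (n ℤ.- + j) → k (ℤ.suc n) j ≈ k′ (ℤ.suc n) j → k n j ≈ k′ n j
        backward n act e = trans (sym (step n j act)) (trans (⊛-cong-≤ g j agree) (step′ n j act))
          where
          agree : ∀ i → i ℕ.≤ j → k (ℤ.suc n) i ≈ k′ (ℤ.suc n) i
          agree i i≤j with ℕP.m≤n⇒m<n∨m≡n i≤j
          ... | inj₁ i<j    = lower n act i i<j
          ... | inj₂ ≡.refl = e

        AgreeAt : ℤ → Set ℓ₁
        AgreeAt d = k (d ℤ.+ + j) j ≈ k′ (d ℤ.+ + j) j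

        recenter : ∀ {d} → Active d → Active (d ℤ.+ + j ℤ.- + j)
        recenter {d} = ≡.subst Active (undo d (+ j))
          where
          undo : ∀ d j → d ≡ d ℤ.+ j ℤ.- j
          undo = solve-∀

        forward-at : ∀ d → Active d → AgreeAt d → AgreeAt (ℤ.suc d)
        forward-at d act e = ≡.subst (λ n → k n j ≈ k′ n j) (≡.sym (ℤP.+-assoc 1ℤ d (+ j)))
          (forward (d ℤ.+ + j) (recenter act) e)

        backward-at : ∀ d → Active d → AgreeAt (ℤ.suc d) → AgreeAt d
        backward-at d act e = backward (d ℤ.+ + j) (recenter act)
          (≡.subst (λ n → k n j ≈ k′ n j) (ℤP.+-assoc 1ℤ d (+ j)) e)

        -- Induction on the offset d = n - j from the diagonal d = 0, where `base` holds. Downwards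
        -- it goes only through active offsets, since everything above an active offset is active.
        agree-at : ∀ d → Active d → AgreeAt d
        agree-at (+ zero)     _   = base j
        agree-at (+ suc d)    _   = forward-at (+ d) (active-+ d) (agree-at (+ d) (active-+ d))
        agree-at -[1+ zero ]  act = backward-at -1ℤ act (base j)
        agree-at -[1+ suc d ] act = backward-at -[1+ suc d ] act
          (agree-at -[1+ d ] (active-≤ (ℤ.-≤- (ℕP.n≤1+n d)) act))

        agree-step : Agree j
        agree-step n act = ≡.subst (λ m → k m j ≈ k′ m j) (undo n (+ j)) (agree-at (n ℤ.- + j) act)
          where
          undo : ∀ n j → n ℤ.- j ℤ.+ j ≡ n
          undo = solve-∀

    unique : ∀ j n → Active (n ℤ.- + j) → k n j ≈ k′ n j
    unique = <-rec Agree (λ j below → agree-step below)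

  -- Which harmonic logarithms vanish.

  -- λ_m^α ≠ 0 exactly in these cases.
  Active : Vector → ℤ → Set
  Active α m = 0ℤ ℤ.≤ m ⊎ ∃[ i ] entry α i ≢ 0ℤ

  active-≤ : ∀ α {i j} → i ℤ.≤ j → Active α i → Active α j
  active-≤ α i≤j (inj₁ 0≤i) = inj₁ (ℤP.≤-trans 0≤i i≤j)
  active-≤ α i≤j (inj₂ α≢0) = inj₂ α≢0

  harmonicLog-self : ∀ m α → 0ℤ ℤ.≤ m → coeff (harmonicLog m α) m α ≈ 1#
  harmonicLog-self (+ n) α _ = trans (harmonic-coeff (+ n) α α)
    (trans (*-cong (reflexive (≡.cong (λ x → ξ (+ n) ∣ x ∣) (ℤP.+-inverseʳ (entry α 0))))
                   (reflexive (≡.cong fromℤ (weight-self α))))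
    (trans (*-cong (ξ-nonneg-0 n) fromℤ-1) (*-identityˡ 1#)))

  -- In negative degree the term with ρ = 0 vanishes, and single columns are the shapes to test
  -- next: their coefficients are the entries of α, so one nonzero entry makes λ_n^α nonzero.
  harmonicLog-ones : ∀ m α i →
    coeff (harmonicLog -[1+ m ] α) -[1+ m ] (α -ᵥ ones (suc i)) ≈ fromℤ (entry α i)
  harmonicLog-ones m α i = trans (harmonic-coeff -[1+ m ] α (α -ᵥ ones (suc i)))
    (trans (*-cong (reflexive (≡.cong (λ x → ξ -[1+ m ] ∣ x ∣) (difference 0)))
                   (reflexive (≡.cong fromℤ (≡.trans
                     (weight-cong α {α -ᵥ (α -ᵥ ones (suc i))} {ones (suc i)} difference)
                     (weight-ones α i)))))
    (trans (*-congʳ (ξ-neg-1 m)) (*-identityˡ _)))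
    where
    difference : α -ᵥ (α -ᵥ ones (suc i)) ≐ ones (suc i)
    difference j = cancel (entry α j) (entry (ones (suc i)) j)
      where
      cancel : ∀ x y → x ℤ.- (x ℤ.- y) ≡ y
      cancel = solve-∀

  active⇒#0 : ∀ m α → Active α m → ∃[ β ] coeff (harmonicLog m α) m β # 0#
  active⇒#0 (+ m)    α _ = α , #-congʳ (sym (harmonicLog-self (+ m) α (ℤ.+≤+ z≤n))) 1#0
  active⇒#0 -[1+ m ] α (inj₂ (i , αᵢ≢0)) = α -ᵥ ones (suc i) ,
    #-congʳ (sym (harmonicLog-ones m α i)) (fromℤ#0 (entry α i) αᵢ≢0)

  harmonicLog-0ᵥ-neg : ∀ m α → α ≐ 0ᵥ → ∀ β → coeff (harmonicLog -[1+ m ] α) -[1+ m ] β ≈ 0#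
  harmonicLog-0ᵥ-neg m α α≐0 β = trans (harmonic-coeff -[1+ m ] α β) product
    where
    ρ = α -ᵥ β
    product : ξ -[1+ m ] ∣ entry ρ 0 ∣ * fromℤ (weight α ρ) ≈ 0#
    product with entry ρ 0 ℤP.≟ 0ℤ
    ... | yes ρ₀≡0 = trans (*-congʳ (trans (reflexive (≡.cong (λ x → ξ -[1+ m ] ∣ x ∣) ρ₀≡0)) (ξ-neg-0 m))) (zeroˡ _)
    ... | no  ρ₀≢0 = trans (*-congˡ (reflexive (≡.cong fromℤ
                       (weight-0ᵥ {α} {ρ} α≐0 (λ ρ≐0 → ρ₀≢0 (ρ≐0 0)))))) (zeroʳ _)

  harmonicLog-0ᵥ-nonneg : ∀ n → harmonicLog (+ n) 0ᵥ ≋ ℓ (+ n) 0ᵥ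
  harmonicLog-0ᵥ-nonneg n m β with m ℤP.≟ + n
  ... | no  _ = refl
  ... | yes ≡.refl = trans
    (reflexive (≡.cong (if_then harmonicCoeff (+ n) 0ᵥ (0ᵥ -ᵥ β) else 0#)
      (≡.sym (dec-true (+ n ℤP.≟ + n) ≡.refl))))
    coefficient
    where
    coefficient : coeff (harmonicLog (+ n) 0ᵥ) (+ n) β ≈ (if does (0ᵥ ≐? β) then 1# else 0#)
    coefficient with 0ᵥ ≐? β
    ... | yes 0≐β = trans (coeff-cong (harmonicLog (+ n) 0ᵥ) (+ n) β 0ᵥ (λ i → ≡.sym (0≐β i)))
      (trans (harmonicLog-self (+ n) 0ᵥ (ℤ.+≤+ z≤n))
             (reflexive (≡.cong (if_then 1# else 0#) (≡.sym (dec-true (0ᵥ ≐? β) 0≐β)))))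
    ... | no  0≢β = trans (harmonic-coeff (+ n) 0ᵥ β)
      (trans (*-congˡ (reflexive (≡.cong fromℤ (weight-0ᵥ {0ᵥ} {0ᵥ -ᵥ β} (λ _ → ≡.refl)
        (λ e → 0≢β (λ i → ≡.sym (ℤP.neg-injective (≡.trans (≡.sym (ℤP.+-identityˡ _)) (e i)))))))))
             (trans (zeroʳ _) (reflexive (≡.cong (if_then 1# else 0#) (≡.sym (dec-false (0ᵥ ≐? β) 0≢β))))))

  nonzero? : ∀ α → (∃[ i ] entry α i ≢ 0ℤ) ⊎ α ≐ 0ᵥ
  nonzero? α with ℕP.anyUpTo? (λ i → ¬? (entry α i ℤP.≟ 0ℤ)) (bound α)
  ... | yes (i , _ , αᵢ≢0) = inj₁ (i , αᵢ≢0)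
  ... | no  none           = inj₂ zeros
    where
    zeros : α ≐ 0ᵥ
    zeros i with i ℕP.<? bound α
    ... | yes i<b = decidable-stable (entry α i ℤP.≟ 0ℤ) (λ αᵢ≢0 → none (i , i<b , αᵢ≢0))
    ... | no  i≮b = vanishes α i (ℕP.≮⇒≥ i≮b)

  active? : ∀ α m → Active α m ⊎ (∀ β → coeff (harmonicLog m α) m β ≈ 0#)
  active? α (+ m)    = inj₁ (inj₁ (ℤ.+≤+ z≤n))
  active? α -[1+ m ] with nonzero? α
  ... | inj₁ α≢0 = inj₁ (inj₂ α≢0)
  ... | inj₂ α≐0 = inj₂ (harmonicLog-0ᵥ-neg m α α≐0)

  expand-injective : ∀ α S T → expand α S ≋ expand α T → ∀ m → Active α m → coef S m ≈ coef T m
  expand-injective α S T e m act with active⇒#0 m α act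
  ... | β , H#0 = *-cancelʳ H#0 (e m β)

  -- The transfer, shift and recurrence formulas.

  module Associated (f : DeltaOperator) where
    open DeltaOperator f

    f′≈g+θg : f′ ≈ₛ quotient +ₛ θ quotient
    f′≈g+θg = derivative-θ {series} (λ _ → refl)

    transferSeries : ℤ → PowerSeries
    transferSeries n = f′ ⊛ g^ (ℤ.- n ℤ.- 1ℤ)

    transferSeries-residue : ∀ n j →
      fromℤ n * transferSeries n j ≈ fromℤ (n ℤ.- + j) * (g^ (ℤ.- n)) j
    transferSeries-residue = residue quotient linear f′≈g+θg

    transferSeries-step : ∀ n → quotient ⊛ transferSeries (ℤ.suc n) ≈ₛ transferSeries n
    transferSeries-step n = S.trans
      (⊛-congˡ quotient (⊛-congˡ f′ (S.reflexive (≡.cong g^_ (exponent n)))))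
      (⊛-swap quotient linear f′ (ℤ.- n ℤ.- 1ℤ))
      where
      exponent : ∀ n → ℤ.- (1ℤ ℤ.+ n) ℤ.- 1ℤ ≡ -1ℤ ℤ.+ (ℤ.- n ℤ.- 1ℤ)
      exponent = solve-∀

    δ : ℤ → Carrier
    δ n = if does (n ℤP.≟ 0ℤ) then 1# else 0#

    -- For j > 0 the residue identity at n = j has the factor n - j = 0 on the right, and n cancels
    -- in characteristic 0. For j = 0 the constant terms of f′ and g agree.
    transferSeries-diagonal : ∀ j → transferSeries (+ j) j ≈ δ (+ j)
    transferSeries-diagonal zero    = begin
      f′ 0 * v 0 + 0#           ≈⟨ +-congʳ (*-congʳ (+-identityʳ (series 1))) ⟩
      (quotient ⊛ v) 0          ≈⟨ zpower-pred quotient linear 0ℤ 0 ⟩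
      1#                        ∎
      where v = g^ -1ℤ
    transferSeries-diagonal (suc j) = *-cancelˡ (char0 (suc j)) (begin
      fromℤ (+ suc j) * transferSeries (+ suc j) (suc j)
        ≈⟨ transferSeries-residue (+ suc j) (suc j) ⟩
      fromℤ (+ suc j ℤ.- + suc j) * (g^ (ℤ.- + suc j)) (suc j)
        ≡⟨ ≡.cong (λ i → fromℤ i * (g^ (ℤ.- + suc j)) (suc j)) (ℤP.+-inverseʳ (+ suc j)) ⟩
      0# * (g^ (ℤ.- + suc j)) (suc j)      ≈⟨ zeroˡ _ ⟩
      0#                                   ≈⟨ zeroʳ _ ⟨
      fromℤ (+ suc j) * 0#                 ∎)

    transferExpansion : ℤ → Expansion
    transferExpansion n = laurent n (⌊ n ⌉! ∙ₛ transferSeries n)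

    shiftedExpansion : ℤ → Expansion
    shiftedExpansion n = laurent (n ℤ.- 1ℤ) (⌊ n ℤ.- 1ℤ ⌉! ∙ₛ g^ (ℤ.- n))

    ⌊⌉≡fromℤ : ∀ n → n ≢ 0ℤ → ⌊ n ⌉ ≡ fromℤ n
    ⌊⌉≡fromℤ (+ zero)  n≢0 = contradiction ≡.refl n≢0
    ⌊⌉≡fromℤ (+ suc n) n≢0 = ≡.refl
    ⌊⌉≡fromℤ -[1+ n ]  n≢0 = ≡.refl

    residue-at : ∀ n m i → n ℤ.- m ≡ i →
      fromℤ n * at (transferSeries n) i ≈ fromℤ m * at (g^ (ℤ.- n)) i
    residue-at n m (+ j) e = trans (transferSeries-residue n j)
      (*-congʳ (reflexive (≡.cong fromℤ (≡.trans (≡.cong (λ i → n ℤ.- i) (≡.sym e)) (undo n m)))))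
      where
      undo : ∀ n m → n ℤ.- (n ℤ.- m) ≡ m
      undo = solve-∀
    residue-at n m -[1+ j ] e = trans (zeroʳ _) (sym (zeroʳ _))

    at-∙ : ∀ x h i → at (x ∙ₛ h) i ≈ x * at h i
    at-∙ x h (+ j)    = refl
    at-∙ x h -[1+ j ] = sym (zeroʳ x)

    -- Since σ sends λ_{m-1} / ⌊m-1⌉! to m λ_m / ⌊m⌉!, also for m = 0, the claim is the residue
    -- identity with j = n - m. The condition on n gives ⌊n⌉ = n.
    shift-transfer : ∀ n → n ≢ 0ℤ → ∀ m →
      coef (transferExpansion n) m ≈ coef (shiftExpansion (shiftedExpansion n)) m
    shift-transfer n n≢0 m = trans expression cases
      where
      i = n ℤ.- m
      Z = at (g^ (ℤ.- n)) i
      expression : coef (transferExpansion n) m ≈ ⌊ n ℤ.- 1ℤ ⌉! * (fromℤ m * Z) * recip! m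
      expression = *-congʳ (begin
        at (⌊ n ⌉! ∙ₛ transferSeries n) i         ≈⟨ at-∙ ⌊ n ⌉! (transferSeries n) i ⟩
        ⌊ n ⌉! * at (transferSeries n) i          ≈⟨ *-congʳ (trans (factorial-pred n) (*-cong
                                                       (reflexive (⌊⌉≡fromℤ n n≢0))
                                                       (reflexive (≡.cong ⌊_⌉! (ℤP.+-comm -1ℤ n))))) ⟩
        fromℤ n * ⌊ n ℤ.- 1ℤ ⌉! * at (transferSeries n) i
          ≈⟨ solve 3 (λ x y z → x :* y :* z := y :* (x :* z)) refl _ _ _ ⟩
        ⌊ n ℤ.- 1ℤ ⌉! * (fromℤ n * at (transferSeries n) i)  ≈⟨ *-congˡ (residue-at n m i ≡.refl) ⟩
        ⌊ n ℤ.- 1ℤ ⌉! * (fromℤ m * Z)             ∎)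
      cases : ⌊ n ℤ.- 1ℤ ⌉! * (fromℤ m * Z) * recip! m ≈ coef (shiftExpansion (shiftedExpansion n)) m
      cases with m ℤP.≟ 0ℤ
      ... | yes ≡.refl = trans (*-congʳ (trans (*-congˡ (zeroˡ Z)) (zeroʳ _))) (zeroˡ _)
      ... | no  m≢0 = begin
        ⌊ n ℤ.- 1ℤ ⌉! * (fromℤ m * Z) * recip! m
          ≈⟨ solve 4 (λ x y z w → x :* (y :* z) :* w := x :* z :* (y :* w)) refl _ _ _ _ ⟩
        ⌊ n ℤ.- 1ℤ ⌉! * Z * (fromℤ m * recip! m)
          ≈⟨ *-cong (sym (at-∙ ⌊ n ℤ.- 1ℤ ⌉! (g^ (ℤ.- n)) i))
                    (trans (*-congʳ (reflexive (≡.sym (⌊⌉≡fromℤ m m≢0)))) (sym (recip!-pred m))) ⟩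
        at (⌊ n ℤ.- 1ℤ ⌉! ∙ₛ g^ (ℤ.- n)) i * recip! (ℤ.pred m)
          ≡⟨ ≡.cong (λ j → at (⌊ n ℤ.- 1ℤ ⌉! ∙ₛ g^ (ℤ.- n)) j * recip! (ℤ.pred m)) (shift n m) ⟩
        at (⌊ n ℤ.- 1ℤ ⌉! ∙ₛ g^ (ℤ.- n)) (n ℤ.- 1ℤ ℤ.- ℤ.pred m) * recip! (ℤ.pred m) ∎
        where
        shift : ∀ n m → n ℤ.- m ≡ n ℤ.- 1ℤ ℤ.- (-1ℤ ℤ.+ m)
        shift = solve-∀

    f′⁻¹-transferSeries : ∀ n → f′⁻¹ ⊛ (⌊ n ℤ.- 1ℤ ⌉! ∙ₛ transferSeries (n ℤ.- 1ℤ)) ≈ₛ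
                                ⌊ n ℤ.- 1ℤ ⌉! ∙ₛ g^ (ℤ.- n)
    f′⁻¹-transferSeries n j = trans (⊛-∙ₛ ⌊ n ℤ.- 1ℤ ⌉! f′⁻¹ (transferSeries (n ℤ.- 1ℤ)) j) (*-congˡ (begin
      (f′⁻¹ ⊛ (f′ ⊛ z)) j   ≈⟨ ⊛-assoc f′⁻¹ f′ z j ⟨
      ((f′⁻¹ ⊛ f′) ⊛ z) j   ≈⟨ ⊛-congʳ z (S.trans (⊛-comm f′⁻¹ f′) (⊛-inverseʳ f′ _)) j ⟩
      (one ⊛ z) j           ≈⟨ ⊛-identityˡ z j ⟩
      z j                   ≡⟨ ≡.cong (λ i → (g^ i) j) (exponent n) ⟩
      (g^ (ℤ.- n)) j        ∎))
      where
      z = g^ (ℤ.- (n ℤ.- 1ℤ) ℤ.- 1ℤ)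
      exponent : ∀ n → ℤ.- (n ℤ.- 1ℤ) ℤ.- 1ℤ ≡ ℤ.- n
      exponent = solve-∀

    shift-0ᵥ : ∀ {F G} → G ≋σ[ 0ᵥ ] F → G ≋ x· F
    shift-0ᵥ {F} {G} (S , F≋S , G≋σS) m β = trans (G≋σS m β) (trans (cases m) (sym (F≋S (ℤ.pred m) β)))
      where
      H : ℤ → Carrier
      H i = coeff (harmonicLog i 0ᵥ) i β
      H-nonneg : ∀ n → H (+ n) ≈ (if does (0ᵥ ≐? β) then 1# else 0#)
      H-nonneg n = trans (harmonicLog-0ᵥ-nonneg n (+ n) β)
        (reflexive (≡.cong (λ b → if b ∧ does (0ᵥ ≐? β) then 1# else 0#) (dec-true (+ n ℤP.≟ + n) ≡.refl)))
      H-neg : ∀ n → H -[1+ n ] ≈ 0#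
      H-neg n = harmonicLog-0ᵥ-neg n 0ᵥ (λ _ → ≡.refl) β
      cases : ∀ m → coef (shiftExpansion S) m * H m ≈ coef S (ℤ.pred m) * H (ℤ.pred m)
      cases (+ zero)  = trans (zeroˡ _) (sym (trans (*-congˡ (H-neg 0)) (zeroʳ _)))
      cases (+ suc n) = *-congˡ (trans (H-nonneg (suc n)) (sym (H-nonneg n)))
      cases -[1+ n ]  = trans (trans (*-congˡ (H-neg n)) (zeroʳ _))
                              (sym (trans (*-congˡ (H-neg (suc n))) (zeroʳ _)))

    module Sequence (p : ℤ → Vector → LogSeries) (logarithmic : IsLogarithmicSequence p)
      (associated : IsAssociated f p) (α : Vector) where

      private
        S[_] : ℤ → Expansion
        S[ n ] = proj₁ (logarithmic n α)

      h : ℤ → PowerSeries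
      h n = normal S[ n ]

      p-laurent : ∀ n → p n α ≋ expand α (laurent n (h n))
      p-laurent n with logarithmic n α
      ... | S , top≡n , _ , p≋S = ≋-trans {p n α} {expand α S} {expand α (laurent n (normal S))} p≋S
        (≡.subst (λ t → expand α S ≋ expand α (laurent t (normal S))) top≡n (expand-laurent α S))

      -- k_n(D) D^{-n} corresponds to p_n^α / ⌊n⌉!.
      k : ℤ → PowerSeries
      k n = recip! n ∙ₛ h n

      h≈k : ∀ n j → h n j ≈ ⌊ n ⌉! * k n j
      h≈k n j = sym (trans (sym (*-assoc _ _ _)) (trans (*-congʳ (recip-inverseʳ ⌊ n ⌉!#0)) (*-identityˡ _)))

      -- As f = D g, degree j of g h_{n+1} is degree j + 1 of f h_{n+1}, that is, the coefficient of
      -- λ_{n-j}. The equation f p_{n+1} = ⌊n+1⌉ p_n reveals it when λ_{n-j}^α ≠ 0.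
      h-step : ∀ n j → Active α (n ℤ.- + j) →
               (quotient ⊛ h (ℤ.suc n)) j ≈ ⌊ ℤ.suc n ⌉ * h n j
      h-step n j act with active⇒#0 (n ℤ.- + j) α act
      ... | β , H#0 = *-cancelʳ (recip#0 ⌊ m ⌉!#0) (*-cancelʳ H#0 (begin
        (quotient ⊛ h (ℤ.suc n)) j * recip! m * H
          ≈⟨ *-congʳ (*-congʳ (trans (+-congʳ (trans (*-congʳ constant) (zeroˡ _))) (+-identityˡ _))) ⟨
        (series ⊛ h (ℤ.suc n)) (suc j) * recip! m * H
          ≡⟨ ≡.cong (λ i → at (series ⊛ h (ℤ.suc n)) i * recip! m * H) (index n (+ j)) ⟨
        coeff (expand α (laurent (ℤ.suc n) (series ⊛ h (ℤ.suc n)))) m β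
          ≈⟨ ⟨D⟩-laurent series (ℤ.suc n) (h (ℤ.suc n)) α m β ⟨
        coeff (series ⟨D⟩ expand α (laurent (ℤ.suc n) (h (ℤ.suc n)))) m β
          ≈⟨ ⟨D⟩-cong {series} {series} {p (ℤ.suc n) α} {expand α (laurent (ℤ.suc n) (h (ℤ.suc n)))}
               (λ _ → refl) (p-laurent (ℤ.suc n)) m β ⟨
        coeff (series ⟨D⟩ p (ℤ.suc n) α) m β
          ≈⟨ proj₂ (associated (ℤ.suc n) α) m β ⟩
        ⌊ ℤ.suc n ⌉ * coeff (p (ℤ.suc n ℤ.- 1ℤ) α) m β
          ≡⟨ ≡.cong (λ i → ⌊ ℤ.suc n ⌉ * coeff (p i α) m β) (suc-1 n) ⟩
        ⌊ ℤ.suc n ⌉ * coeff (p n α) m β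
          ≈⟨ *-congˡ (p-laurent n m β) ⟩
        ⌊ ℤ.suc n ⌉ * (at (h n) (n ℤ.- m) * recip! m * H)
          ≡⟨ ≡.cong (λ i → ⌊ ℤ.suc n ⌉ * (at (h n) i * recip! m * H)) (index′ n (+ j)) ⟩
        ⌊ ℤ.suc n ⌉ * (h n j * recip! m * H)
          ≈⟨ solve 4 (λ x y z w → x :* (y :* z :* w) := x :* y :* z :* w) refl _ _ _ _ ⟩
        ⌊ ℤ.suc n ⌉ * h n j * recip! m * H ∎))
        where
        m = n ℤ.- + j
        H = coeff (harmonicLog m α) m β
        index : ∀ n j → (1ℤ ℤ.+ n) ℤ.- (n ℤ.- j) ≡ 1ℤ ℤ.+ j
        index = solve-∀
        index′ : ∀ n j → n ℤ.- (n ℤ.- j) ≡ j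
        index′ = solve-∀
        suc-1 : ∀ n → (1ℤ ℤ.+ n) ℤ.- 1ℤ ≡ n
        suc-1 = solve-∀

      k-step : ∀ n j → Active α (n ℤ.- + j) → (quotient ⊛ k (ℤ.suc n)) j ≈ k n j
      k-step n j act = begin
        (quotient ⊛ k (ℤ.suc n)) j                    ≈⟨ ⊛-∙ₛ (recip! (ℤ.suc n)) quotient (h (ℤ.suc n)) j ⟩
        recip! (ℤ.suc n) * (quotient ⊛ h (ℤ.suc n)) j ≈⟨ *-congˡ (h-step n j act) ⟩
        recip! (ℤ.suc n) * (⌊ ℤ.suc n ⌉ * h n j)      ≈⟨ solve 3 (λ x y z → x :* (y :* z) := y :* x :* z) refl _ _ _ ⟩
        ⌊ ℤ.suc n ⌉ * recip! (ℤ.suc n) * h n j        ≈⟨ *-congʳ (recip!-suc n) ⟨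
        recip! n * h n j                              ∎

      0-active : ∀ n → Active α (+ n)
      0-active n = inj₁ (ℤ.+≤+ z≤n)

      -- The augmentation refers to some expansion of p_j^α; as λ_0^α ≠ 0, every expansion has the
      -- same coefficient of λ_0^α, in particular the Laurent form.
      h-diagonal : ∀ j → h (+ j) j * recip! 0ℤ ≈ δ (+ j)
      h-diagonal j with proj₁ (associated (+ j) α)
      ... | S , p≋S , S₀≈δ = begin
        h (+ j) j * recip! 0ℤ                    ≡⟨ ≡.cong (λ i → at (h (+ j)) i * recip! 0ℤ) (ℤP.+-identityʳ (+ j)) ⟨
        coef (laurent (+ j) (h (+ j))) 0ℤ        ≈⟨ expand-injective α (laurent (+ j) (h (+ j))) S
                                                      (≋-trans {expand α (laurent (+ j) (h (+ j)))} {p (+ j) α} {expand α S}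
                                                        (≋-sym {p (+ j) α} {expand α (laurent (+ j) (h (+ j)))} (p-laurent (+ j))) p≋S)
                                                      0ℤ (0-active 0) ⟩
        coef S 0ℤ                                ≈⟨ S₀≈δ ⟩
        δ (+ j)                                  ∎

      k-diagonal : ∀ j → k (+ j) j ≈ transferSeries (+ j) j
      k-diagonal zero    = trans (*-comm _ _) (trans (h-diagonal 0) (sym (transferSeries-diagonal 0)))
      k-diagonal (suc j) = trans (*-congˡ h≈0) (trans (zeroʳ _) (sym (transferSeries-diagonal (suc j))))
        where
        h≈0 : h (+ suc j) (suc j) ≈ 0#
        h≈0 = *-cancelʳ (recip#0 ⌊ 0ℤ ⌉!#0) (trans (h-diagonal (suc j)) (sym (zeroˡ _)))

      k≈transferSeries : ∀ j n → Active α (n ℤ.- + j) → k n j ≈ transferSeries n j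
      k≈transferSeries = unique quotient linear k transferSeries (Active α) (active-≤ α) 0-active
        k-step (λ n j _ → transferSeries-step n j) k-diagonal

      -- In an inactive degree m the two coefficients are not compared, but there λ_m^α itself is 0.
      p-transfer : ∀ n → p n α ≋ expand α (transferExpansion n)
      p-transfer n m β = trans (p-laurent n m β) cases
        where
        H = coeff (harmonicLog m α) m β
        compare : ∀ i → n ℤ.- i ≡ m → Active α m → at (h n) i ≈ at (⌊ n ⌉! ∙ₛ transferSeries n) i
        compare (+ j) e act = trans (h≈k n j)
          (*-congˡ (k≈transferSeries j n (≡.subst (Active α) (≡.sym e) act)))
        compare -[1+ j ] e act = refl
        undo : ∀ n m → n ℤ.- (n ℤ.- m) ≡ m
        undo = solve-∀
        cases : at (h n) (n ℤ.- m) * recip! m * H ≈ at (⌊ n ⌉! ∙ₛ transferSeries n) (n ℤ.- m) * recip! m * H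
        cases with active? α m
        ... | inj₁ act = *-congʳ (*-congʳ (compare (n ℤ.- m) (undo n m) act))
        ... | inj₂ H≈0 = trans (trans (*-congˡ (H≈0 β)) (zeroʳ _)) (sym (trans (*-congˡ (H≈0 β)) (zeroʳ _)))

      transfer : ∀ n → p n α ≋ transferSeries n ⟨D⟩ harmonicLog n α
      transfer n m β = trans (p-transfer n m β) (sym (⟨D⟩-harmonicLog (transferSeries n) n α m β))

      p-shift : ∀ n → n ≢ 0ℤ → p n α ≋ expand α (shiftExpansion (shiftedExpansion n))
      p-shift n n≢0 = ≋-trans {p n α} {expand α (transferExpansion n)} {expand α (shiftExpansion (shiftedExpansion n))}
        (p-transfer n)
        (expand-cong {α} {transferExpansion n} {shiftExpansion (shiftedExpansion n)} (shift-transfer n n≢0))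

      shift : ∀ n → n ≢ 0ℤ → p n α ≋σ[ α ] (g^ (ℤ.- n) ⟨D⟩ harmonicLog (n ℤ.- 1ℤ) α)
      shift n n≢0 = shiftedExpansion n , ⟨D⟩-harmonicLog (g^ (ℤ.- n)) (n ℤ.- 1ℤ) α , p-shift n n≢0

      -- `f′⁻¹` cancels the f′ in the transfer series of p_{n-1}, leaving the argument of σ from the
      -- shift formula. At n = 0 the equation fails: the image of σ has no λ_0, whereas p_0 has the
      -- coefficient 1 there.
      recurrence : ∀ n → n ≢ 0ℤ → p n α ≋σ[ α ] (f′⁻¹ ⟨D⟩ p (n ℤ.- 1ℤ) α)
      recurrence n n≢0 = shiftedExpansion n , quotients , p-shift n n≢0
        where
        quotients : f′⁻¹ ⟨D⟩ p (n ℤ.- 1ℤ) α ≋ expand α (shiftedExpansion n)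
        quotients m β = trans
          (⟨D⟩-cong {f′⁻¹} {f′⁻¹} {p (n ℤ.- 1ℤ) α} {expand α (transferExpansion (n ℤ.- 1ℤ))}
            (λ _ → refl) (p-transfer (n ℤ.- 1ℤ)) m β)
          (trans (⟨D⟩-laurent f′⁻¹ (n ℤ.- 1ℤ) (⌊ n ℤ.- 1ℤ ⌉! ∙ₛ transferSeries (n ℤ.- 1ℤ)) α m β)
            (laurent-cong {α} {n ℤ.- 1ℤ} (f′⁻¹-transferSeries n) m β))

    module Polynomials (p : ℤ → Vector → LogSeries) (logarithmic : IsLogarithmicSequence p)
      (associated : IsAssociated f p) where
      open Sequence p logarithmic associated 0ᵥ

      ⟨D⟩-power : ∀ a n → a ⟨D⟩ harmonicLog (+ n) 0ᵥ ≋ a ⟨D⟩ ℓ (+ n) 0ᵥ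
      ⟨D⟩-power a n = ⟨D⟩-cong {a} {a} {harmonicLog (+ n) 0ᵥ} {ℓ (+ n) 0ᵥ} (λ _ → refl) (harmonicLog-0ᵥ-nonneg n)

      transfer-polynomial : ∀ n → p (+ n) 0ᵥ ≋ transferSeries (+ n) ⟨D⟩ ℓ (+ n) 0ᵥ
      transfer-polynomial n m β = trans (transfer (+ n) m β) (⟨D⟩-power (transferSeries (+ n)) n m β)

      shift-polynomial : ∀ n → 1 ℕ.≤ n → p (+ n) 0ᵥ ≋ x· (g^ (ℤ.- + n) ⟨D⟩ ℓ (+ n ℤ.- 1ℤ) 0ᵥ)
      shift-polynomial (suc n) _ m β = trans
        (shift-0ᵥ {g^ (ℤ.- + suc n) ⟨D⟩ harmonicLog (+ n) 0ᵥ} {p (+ suc n) 0ᵥ} (shift (+ suc n) (λ ())) m β)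
        (⟨D⟩-power (g^ (ℤ.- + suc n)) n (ℤ.pred m) β)

      recurrence-polynomial : ∀ n → 1 ℕ.≤ n → p (+ n) 0ᵥ ≋ x· (f′⁻¹ ⟨D⟩ p (+ n ℤ.- 1ℤ) 0ᵥ)
      recurrence-polynomial (suc n) _ = shift-0ᵥ {f′⁻¹ ⟨D⟩ p (+ n) 0ᵥ} {p (+ suc n) 0ᵥ}
        (recurrence (+ suc n) (λ ()))

open import Data.Integer.Base using (-_; _-_)
open import Data.Nat.Base using (_≤_)

theorem16 : ∀ {c ℓ₁ ℓ₂} (K : HeytingField c ℓ₁ ℓ₂) (char0 : CharacteristicZero K) →
    let open LogarithmicAlgebra K char0 in
    (f : DeltaOperator) (p : ℤ → Vector → LogSeries) →
    IsLogarithmicSequence p → IsAssociated f p →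
    let open DeltaOperator f in
    (∀ α →
    (∀ n → p n α ≋ (f′ ⊛ g^ (- n - 1ℤ)) ⟨D⟩ harmonicLog n α) ×
    (∀ n → n ≢ 0ℤ → n ≢ -1ℤ → p n α ≋σ[ α ] (g^ (- n) ⟨D⟩ harmonicLog (n - 1ℤ) α)) ×
    (∀ n → n ≢ 0ℤ → p n α ≋σ[ α ] (f′⁻¹ ⟨D⟩ p (n - 1ℤ) α))) ×
    (∀ (n : ℕ) → p (+ n) 0ᵥ ≋ (f′ ⊛ g^ (- (+ n) - 1ℤ)) ⟨D⟩ ℓ (+ n) 0ᵥ) ×
    (∀ (n : ℕ) → 1 ≤ n → p (+ n) 0ᵥ ≋ x· (g^ (- (+ n)) ⟨D⟩ ℓ (+ n - 1ℤ) 0ᵥ)) ×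
    (∀ (n : ℕ) → 1 ≤ n → p (+ n) 0ᵥ ≋ x· (f′⁻¹ ⟨D⟩ p (+ n - 1ℤ) 0ᵥ))
theorem16 K char0 f p logarithmic associated =
  (λ α → let open Sequence p logarithmic associated α in
         transfer , (λ n n≢0 _ → shift n n≢0) , recurrence) ,
  transfer-polynomial , shift-polynomial , recurrence-polynomial
  where
  open Logarithmic.Associated K char0 f
  open Polynomials p logarithmic associated
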